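{- Let $T \notin \{P_5, P_6\}$ be a tree of order $n \ge 4$. Then $\gamma_t^d(T) \le 2(n-1)/3$, with equality if and only if $T \in \mathcal{T} \cup \mathcal{F} \cup \{K_{1,3}, T^*\}$.
   Context: For a graph $G$ with no isolated vertex, a set $S \subseteq V(G)$ is a disjunctive total dominating set if every vertex of $G$ either is adjacent to a vertex of $S$ or has at least two vertices of $S$ at distance exactly $2$ from it; $\gamma_t^d(G)$ is the minimum cardinality of such a set. $P_m$ is the path on $m$ vertices. For $k \ge 1$, $T_k$ is the tree obtained from the star $K_{1,k}$ by subdividing every edge exactly twice (so $T_1 = P_4$), and $\mathcal{T} = \{T_k : k \ge 1\}$. For $k \ge 2$, $F_k$ is the tree obtained from $T_k$ by deleting an edge $uv$ incident with the central vertex $v$ of $T_k$ and adding the edge $uw$ for some neighbor $w$ of $v$ different from $u$, and $\mathcal{F} = \{F_k : k \ge 2\}$. $T^*$ is the tree of order $7$ obtained from the star $K_{1,3}$ by subdividing one edge three times. -}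

module Defs where

open import Data.Nat using (ℕ; zero; suc; _+_; _*_; _≡ᵇ_; _≤_; _∸_)
open import Data.Bool using (Bool; true; false; _∧_; _∨_)
open import Data.Fin using (Fin; toℕ; fromℕ)
open import Data.Fin.Subset using (Subset; _∈_)
open import Data.List using (List; []; _∷_; concatMap; upTo; _++_)
open import Data.Bool.ListAction using (any)
open import Data.Product using (Σ; ∃; ∃-syntax; _×_; _,_)
open import Data.Sum using (_⊎_)
open import Relation.Binary.PropositionalEquality using (_≡_; _≢_)
open import Relation.Nullary using (¬_)
open import Function.Bundles using (_↔_; Inverse)

Graph : ℕ → Set
Graph n = Fin n → Fin n → Bool

Symmetric : ∀ {n} → Graph n → Set
Symmetric {n} G = (u v : Fin n) → G u v ≡ G v u

Irreflexive : ∀ {n} → Graph n → Set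
Irreflexive {n} G = (u : Fin n) → G u u ≡ false

data Walk {n : ℕ} (G : Graph n) : Fin n → Fin n → Set where
  here : ∀ {u} → Walk G u u
  step : ∀ {u w v} → G u w ≡ true → Walk G w v → Walk G u v

Connected : ∀ {n} → Graph n → Set
Connected {n} G = (u v : Fin n) → Walk G u v

record Cycle {n : ℕ} (G : Graph n) : Set where
  field
    k       : ℕ
    c       : Fin (3 + k) → Fin n
    inj     : (i j : Fin (3 + k)) → c i ≡ c j → i ≡ j
    consec  : (i j : Fin (3 + k)) → toℕ j ≡ suc (toℕ i) → G (c i) (c j) ≡ true
    closing : G (c (fromℕ (2 + k))) (c Fin.zero) ≡ true

Acyclic : ∀ {n} → Graph n → Set
Acyclic G = ¬ Cycle G

IsTree : ∀ {n} → Graph n → Set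
IsTree G = Connected G × Acyclic G

Dist2 : ∀ {n} → Graph n → Fin n → Fin n → Set
Dist2 {n} G u w = (u ≢ w) × (G u w ≡ false) × (∃[ x ] (G u x ≡ true × G x w ≡ true))

IsDTD : ∀ {n} → Graph n → Subset n → Set
IsDTD {n} G S = (v : Fin n) →
  (∃[ u ] (u ∈ S × G v u ≡ true))
  ⊎ (∃[ u ] ∃[ w ] (u ≢ w × u ∈ S × w ∈ S × Dist2 G v u × Dist2 G v w))

IsGammaTd : ∀ {n} → Graph n → ℕ → Set
IsGammaTd {n} G k =
  (∃[ S ] (IsDTD G S × Data.Fin.Subset.∣ S ∣ ≡ k))
  × ((S : Subset n) → IsDTD G S → k ≤ Data.Fin.Subset.∣ S ∣)

_≅_ : ∀ {n m} → Graph n → Graph m → Set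
_≅_ {n} {m} G H = Σ (Fin n ↔ Fin m) λ f →
  (u v : Fin n) → G u v ≡ H (Inverse.to f u) (Inverse.to f v)

fromEdges : (n : ℕ) → List (ℕ × ℕ) → Graph n
fromEdges n es a b = any match es
  where
    match : ℕ × ℕ → Bool
    match (x , y) = ((toℕ a ≡ᵇ x) ∧ (toℕ b ≡ᵇ y)) ∨ ((toℕ a ≡ᵇ y) ∧ (toℕ b ≡ᵇ x))

pathEdges : ℕ → List (ℕ × ℕ)
pathEdges zero = []
pathEdges (suc zero) = []
pathEdges (suc (suc m)) = (m , suc m) ∷ pathEdges (suc m)

P : (m : ℕ) → Graph m
P m = fromEdges m (pathEdges m)

branchPath : ℕ → List (ℕ × ℕ)
branchPath i = (1 + 3 * i , 2 + 3 * i) ∷ (2 + 3 * i , 3 + 3 * i) ∷ []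

-- T_k: K_{1,k} with every edge subdivided twice; center 0, order 3k+1.
TkEdges : ℕ → List (ℕ × ℕ)
TkEdges k = concatMap (λ i → (0 , 1 + 3 * i) ∷ branchPath i) (upTo k)

Tk : (k : ℕ) → Graph (suc (3 * k))
Tk k = fromEdges (suc (3 * k)) (TkEdges k)

-- F_k: from T_k delete the edge 0–1 (u = 1, v = 0) and add the edge 1–4
-- (w = 4, another neighbour of the centre). (All such choices are isomorphic.)
FkEdges : ℕ → List (ℕ × ℕ)
FkEdges k = (1 , 4) ∷ concatMap branchPath (upTo k)
            ++ concatMap (λ i → (0 , 4 + 3 * i) ∷ []) (upTo (k ∸ 1))

Fk : (k : ℕ) → Graph (suc (3 * k))
Fk k = fromEdges (suc (3 * k)) (FkEdges k)

K13 : Graph 4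
K13 = fromEdges 4 ((0 , 1) ∷ (0 , 2) ∷ (0 , 3) ∷ [])

-- T*: K_{1,3} (centre 0, leaves 1,2,3) with edge 0–3 subdivided three times
-- by 4,5,6: 0–4–5–6–3.
Tstar : Graph 7
Tstar = fromEdges 7 ((0 , 1) ∷ (0 , 2) ∷ (0 , 4) ∷ (4 , 5) ∷ (5 , 6) ∷ (6 , 3) ∷ [])

InExtremalFamily : ∀ {n} → Graph n → Set
InExtremalFamily G =
  (∃[ k ] (1 ≤ k × G ≅ Tk k))
  ⊎ (∃[ k ] (2 ≤ k × G ≅ Fk k))
  ⊎ (G ≅ K13)
  ⊎ (G ≅ Tstar)

{-# OPTIONS --safe #-}
-- Build a rooted tree from single vertices by repeatedly hanging one rooted tree below the root of
-- another (t ⊕ c). For a rooted tree, record which partial dominating sets it is guaranteed to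
-- have: whether the root is selected, how many of its children are, how much the root and its
-- children still lack, and how far 3|S| lies below 2|t|. Finitely many shapes suffice: eighteen
-- lists of such guarantees are closed under ⊕. Thirteen of them belong to the parts into which an
-- extremal tree (or P₅, P₆) can be cut, and determine the tree accordingly; the other five leave
-- enough slack never to reach the bound. Reading off the shape of the tree hanging below a leaf
-- gives the bound and all candidates for equality. Conversely, the extremal trees attain it because
-- their pendant paths on three vertices force two selected vertices each.
module Submission where

open import Defs

open import Data.Bool using (Bool; true; false; _∧_; _∨_; if_then_else_)
import Data.Bool as Bool
open import Data.Bool.ListAction using (any)
open import Data.Bool.Properties using (∧-comm; ∧-zeroʳ; ∨-assoc; ∨-identityʳ; ∨-zeroʳ)
open import Data.Bool.Solver using (module ∨-∧-Solver)
open import Data.Empty using (⊥; ⊥-elim)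
open import Data.Fin as Fin using (Fin; toℕ; fromℕ; fromℕ<; _↑ˡ_; _↑ʳ_; #_)
import Data.Fin.Properties as Fin
open import Data.Fin.Permutation using (↔⇒≡)
open import Data.Fin.Subset using (Subset; ∣_∣)
open import Data.List using (List; []; _∷_; _++_; map; length; lookup; concatMap; upTo)
open import Data.List.Membership.Propositional using (_∈_)
open import Data.List.Membership.Propositional.Properties using (∈-map⁻; ∈-lookup)
open import Data.List.Properties using (upTo-∷ʳ; concatMap-++; ++-identityʳ)
open import Data.List.Relation.Unary.All as All using (All; []; _∷_)
import Data.List.Relation.Unary.All.Properties as All
open import Data.List.Relation.Unary.AllPairs using ([]; _∷_)
open import Data.List.Relation.Unary.Any as Any using (Any; here; there)
open import Data.List.Relation.Unary.Unique.Propositional using (Unique)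
import Data.List.Relation.Unary.Unique.Propositional.Properties as Unique
open import Data.Maybe using (Maybe; just; nothing; maybe)
import Data.Maybe as Maybe
open import Data.Nat using (ℕ; zero; suc; _+_; _*_; _∸_; _≤_; _<_; _≤?_; _<?_; _≡ᵇ_; z≤n; s≤s)
open import Data.Nat.Properties
open import Algebra.Properties.CommutativeMonoid.Sum +-0-commutativeMonoid using (sum; sum-permute; sum-cong-≗)
open import Data.Nat.Solver using (module +-*-Solver)
open import Data.Product using (Σ; ∃; ∃-syntax; _×_; _,_; proj₁; proj₂)
open import Data.Sum as Sum using (_⊎_; inj₁; inj₂; [_,_]; swap)
open import Data.Sum.Algebra using (⊎-comm)
open import Data.Sum.Function.Propositional using (_⊎-↔_)
open import Data.Sum.Properties using (inj₁-injective; inj₂-injective)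
open import Data.Unit using (⊤; tt)
open import Data.Vec as Vec using (Vec; []; _∷_; tabulate)
open import Data.Vec.Properties using ([]=⇒lookup; lookup⇒[]=; lookup∘tabulate)
open import Function using (_∘_; case_of_; Injective)
open import Function.Bundles using (_↔_; Inverse; mk↔ₛ′; _⇔_; mk⇔)
open import Function.Properties.Inverse using (↔-refl; ↔-sym; ↔-trans)
open import Relation.Binary.PropositionalEquality using (_≡_; _≢_; refl; sym; trans; cong; cong₂; subst; subst₂; module ≡-Reasoning)
open import Relation.Nullary using (¬_; Dec; yes; no; contradiction)
open import Relation.Nullary.Decidable using (map′; _×-dec_; _⊎-dec_; _→-dec_; True; toWitness)

-- An induction on the bound alone breaks down: cutting an edge may leave `P₅`, `P₆` or a part too
-- small for the bound, and a cheap set on one part can leave vertices near the cut undominated. So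
-- each part carries several offers at once. Their format is finite because hanging a tree below the
-- root affects the domination of the two roots and their children only, and because two selected
-- vertices at distance 2 are as good as more.
--
-- Equality requires more than numbers: a shape has to remember enough of its tree as long as the
-- tree can still grow into an extremal one. Children arrive one at a time in an arbitrary order, so
-- the intermediate stages of such a growth need shapes too. The final inspection is made from a
-- leaf, where attaining the bound means that the part below is an extremal tree without one vertex.
-- A complete extremal tree met at an inner root may therefore already count as slack.

infixl 6 _⊕_

-- t ⊕ c hangs c as a further child below the root of t.
data RTree : Set where
  •   : RTree
  _⊕_ : (t c : RTree) → RTree

-- Vertices and adjacency of rooted trees.

V : RTree → Set
V •       = ⊤
V (t ⊕ c) = V t ⊎ V c

size : RTree → ℕ
size •       = 1
size (t ⊕ c) = size t + size c

root : ∀ t → V t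
root •       = tt
root (t ⊕ c) = inj₁ (root t)

isRoot : ∀ t → V t → Bool
isRoot •       _        = true
isRoot (t ⊕ c) (inj₁ v) = isRoot t v
isRoot (t ⊕ c) (inj₂ _) = false

adj : ∀ t → V t → V t → Bool
adj •       _        _        = false
adj (t ⊕ c) (inj₁ u) (inj₁ v) = adj t u v
adj (t ⊕ c) (inj₁ u) (inj₂ v) = isRoot t u ∧ isRoot c v
adj (t ⊕ c) (inj₂ u) (inj₁ v) = isRoot c u ∧ isRoot t v
adj (t ⊕ c) (inj₂ u) (inj₂ v) = adj c u v

∧-true : ∀ {a b} → a ∧ b ≡ true → a ≡ true × b ≡ true
∧-true {true} {true} refl = refl , refl

∨-true : ∀ {a b} → a ∨ b ≡ true → a ≡ true ⊎ b ≡ true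
∨-true {true}         refl = inj₁ refl
∨-true {false} {true} refl = inj₂ refl

true⊎false : ∀ b → b ≡ true ⊎ b ≡ false
true⊎false true  = inj₁ refl
true⊎false false = inj₂ refl

true≢false : ∀ {b} → b ≡ true → b ≡ false → ⊥
true≢false refl ()

isRoot-root : ∀ t → isRoot t (root t) ≡ true
isRoot-root •       = refl
isRoot-root (t ⊕ c) = isRoot-root t

isRoot⇒≡ : ∀ t v → isRoot t v ≡ true → v ≡ root t
isRoot⇒≡ •       _        _ = refl
isRoot⇒≡ (t ⊕ c) (inj₁ v) r = cong inj₁ (isRoot⇒≡ t v r)

adj-sym : ∀ t u v → adj t u v ≡ adj t v u
adj-sym •       _        _        = refl
adj-sym (t ⊕ c) (inj₁ u) (inj₁ v) = adj-sym t u v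
adj-sym (t ⊕ c) (inj₁ u) (inj₂ v) = ∧-comm (isRoot t u) _
adj-sym (t ⊕ c) (inj₂ u) (inj₁ v) = ∧-comm (isRoot c u) _
adj-sym (t ⊕ c) (inj₂ u) (inj₂ v) = adj-sym c u v

adj-irrefl : ∀ t v → adj t v v ≡ false
adj-irrefl •       _        = refl
adj-irrefl (t ⊕ c) (inj₁ v) = adj-irrefl t v
adj-irrefl (t ⊕ c) (inj₂ v) = adj-irrefl c v

-- Isomorphisms

Iso : {A B : Set} → (A → A → Bool) → (B → B → Bool) → Set
Iso {A} {B} E F = Σ (A ↔ B) λ f → ∀ u v → E u v ≡ F (Inverse.to f u) (Inverse.to f v)

module _ {A B : Set} {E : A → A → Bool} {F : B → B → Bool} where

  Iso-sym : Iso E F → Iso F E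
  Iso-sym (f , p) = ↔-sym f , λ u v →
    sym (trans (p _ _) (cong₂ F (Inverse.strictlyInverseˡ f u) (Inverse.strictlyInverseˡ f v)))

  Iso-trans : {C : Set} {H : C → C → Bool} → Iso E F → Iso F H → Iso E H
  Iso-trans (f , p) (g , q) = ↔-trans f g , λ u v → trans (p u v) (q _ _)

infix 4 _~_ _≈_

-- A record rather than a synonym, so that unification can recover `t` and `u`, which `adj t` and
-- `adj u` alone do not determine.
record _~_ (t u : RTree) : Set where
  constructor mk~
  field iso : Iso (adj t) (adj u)

open _~_

-- Hanging depends on where the roots are, so this finer relation is the congruence for `⊕`; the
-- coarser `~` permits re-rooting.
record _≈_ (t u : RTree) : Set where
  constructor mk≈
  field
    unrooted   : t ~ u
    keeps-root : ∀ v → isRoot t v ≡ isRoot u (Inverse.to (proj₁ (iso unrooted)) v)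

open _≈_ using (unrooted)

~-sym : ∀ {t u} → t ~ u → u ~ t
~-sym {t} {u} (mk~ f) = mk~ (Iso-sym {E = adj t} {adj u} f)

~-trans : ∀ {t u w} → t ~ u → u ~ w → t ~ w
~-trans {t} {u} {w} (mk~ f) (mk~ g) = mk~ (Iso-trans {E = adj t} {adj u} {H = adj w} f g)

≈-refl : ∀ {t} → t ≈ t
≈-refl = mk≈ (mk~ (↔-refl , λ _ _ → refl)) λ _ → refl

~-refl : ∀ {t} → t ~ t
~-refl = unrooted ≈-refl

≈-trans : ∀ {t u w} → t ≈ u → u ≈ w → t ≈ w
≈-trans (mk≈ f p) (mk≈ g q) = mk≈ (~-trans f g) λ v → trans (p v) (q _)

⊕-cong : ∀ {t t′ c c′} → t ≈ t′ → c ≈ c′ → t ⊕ c ≈ t′ ⊕ c′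
⊕-cong {t} {t′} {c} {c′} (mk≈ (mk~ (f , p)) r) (mk≈ (mk~ (g , q)) s) =
  mk≈ (mk~ ((f ⊎-↔ g) , preserves)) keeps-root
  where
  preserves : ∀ u v → adj (t ⊕ c) u v ≡ adj (t′ ⊕ c′) (Inverse.to (f ⊎-↔ g) u) (Inverse.to (f ⊎-↔ g) v)
  preserves (inj₁ u) (inj₁ v) = p u v
  preserves (inj₁ u) (inj₂ v) = cong₂ _∧_ (r u) (s v)
  preserves (inj₂ u) (inj₁ v) = cong₂ _∧_ (s u) (r v)
  preserves (inj₂ u) (inj₂ v) = q u v
  keeps-root : ∀ v → isRoot (t ⊕ c) v ≡ isRoot (t′ ⊕ c′) (Inverse.to (f ⊎-↔ g) v)
  keeps-root (inj₁ v) = r v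
  keeps-root (inj₂ _) = refl

⊕-congˡ : ∀ {t t′ c} → t ≈ t′ → t ⊕ c ≈ t′ ⊕ c
⊕-congˡ p = ⊕-cong p ≈-refl

⊕-congʳ : ∀ {t c c′} → c ≈ c′ → t ⊕ c ≈ t ⊕ c′
⊕-congʳ p = ⊕-cong ≈-refl p

⊕-exchange : ∀ t a b → t ⊕ a ⊕ b ≈ t ⊕ b ⊕ a
⊕-exchange t a b = mk≈ (mk~ (mk↔ₛ′ (σ {B = V a}) σ σ-involutive σ-involutive , preserves)) keeps-root
  where
  σ : {A B C : Set} → (A ⊎ B) ⊎ C → (A ⊎ C) ⊎ B
  σ (inj₁ (inj₁ x)) = inj₁ (inj₁ x)
  σ (inj₁ (inj₂ y)) = inj₂ y
  σ (inj₂ z)        = inj₁ (inj₂ z)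
  σ-involutive : {A B C : Set} (x : (A ⊎ B) ⊎ C) → σ (σ x) ≡ x
  σ-involutive (inj₁ (inj₁ x)) = refl
  σ-involutive (inj₁ (inj₂ y)) = refl
  σ-involutive (inj₂ z)        = refl
  preserves : ∀ u v → adj (t ⊕ a ⊕ b) u v ≡ adj (t ⊕ b ⊕ a) (σ u) (σ v)
  preserves (inj₁ (inj₁ u)) (inj₁ (inj₁ v)) = refl
  preserves (inj₁ (inj₁ u)) (inj₁ (inj₂ v)) = refl
  preserves (inj₁ (inj₁ u)) (inj₂ v)        = refl
  preserves (inj₁ (inj₂ u)) (inj₁ (inj₁ v)) = refl
  preserves (inj₁ (inj₂ u)) (inj₁ (inj₂ v)) = refl
  preserves (inj₁ (inj₂ u)) (inj₂ v)        = sym (∧-zeroʳ (isRoot a u))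
  preserves (inj₂ u)        (inj₁ (inj₁ v)) = refl
  preserves (inj₂ u)        (inj₁ (inj₂ v)) = ∧-zeroʳ (isRoot b u)
  preserves (inj₂ u)        (inj₂ v)        = refl
  keeps-root : ∀ v → isRoot (t ⊕ a ⊕ b) v ≡ isRoot (t ⊕ b ⊕ a) (σ v)
  keeps-root (inj₁ (inj₁ _)) = refl
  keeps-root (inj₁ (inj₂ _)) = refl
  keeps-root (inj₂ _)        = refl

⊕-comm : ∀ t c → t ⊕ c ~ c ⊕ t
⊕-comm t c = mk~ (⊎-comm (V t) (V c) , preserves)
  where
  preserves : ∀ u v → adj (t ⊕ c) u v ≡ adj (c ⊕ t) (swap u) (swap v)
  preserves (inj₁ _) (inj₁ _) = refl
  preserves (inj₁ _) (inj₂ _) = refl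
  preserves (inj₂ _) (inj₁ _) = refl
  preserves (inj₂ _) (inj₂ _) = refl

-- The edge joining the two roots can be read from either end: the root moves to the last child, and
-- `t` becomes a child there.
⊕-rotate : ∀ t a b → t ⊕ (a ⊕ b) ~ a ⊕ t ⊕ b
⊕-rotate t a b = ~-trans (⊕-comm t (a ⊕ b)) (unrooted (⊕-exchange a b t))

-- The root descends through last children. Each rotation shrinks the second argument until it is a
-- single vertex, which then becomes the root.
rootAtLeaf : ∀ t c → ∃[ c′ ] t ⊕ c ~ • ⊕ c′
rootAtLeaf t •       = t , ⊕-comm t •
rootAtLeaf t (a ⊕ b) with rootAtLeaf (a ⊕ t) b
... | c′ , p = c′ , ~-trans (⊕-rotate t a b) p

-- Counting and domination

indicator : Bool → ℕ
indicator b = if b then 1 else 0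

count : ∀ t → (V t → Bool) → ℕ
count •       S = indicator (S tt)
count (t ⊕ c) S = count t (S ∘ inj₁) + count c (S ∘ inj₂)

indicator≤1 : ∀ b → indicator b ≤ 1
indicator≤1 true  = s≤s z≤n
indicator≤1 false = z≤n

indicator-mono : ∀ {a b} → (a ≡ true → b ≡ true) → indicator a ≤ indicator b
indicator-mono {false}        _ = z≤n
indicator-mono {true} {true}  _ = s≤s z≤n
indicator-mono {true} {false} f with () ← f refl

count-mono : ∀ t {p q : V t → Bool} → (∀ v → p v ≡ true → q v ≡ true) → count t p ≤ count t q
count-mono •       f = indicator-mono (f tt)
count-mono (t ⊕ c) f = +-mono-≤ (count-mono t (f ∘ inj₁)) (count-mono c (f ∘ inj₂))

count-cong : ∀ t {p q : V t → Bool} → (∀ v → p v ≡ q v) → count t p ≡ count t q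
count-cong •       f = cong indicator (f tt)
count-cong (t ⊕ c) f = cong₂ _+_ (count-cong t (f ∘ inj₁)) (count-cong c (f ∘ inj₂))

indicator≤count : ∀ t (p : V t → Bool) v → indicator (p v) ≤ count t p
indicator≤count •       p _        = ≤-refl
indicator≤count (t ⊕ c) p (inj₁ v) = ≤-trans (indicator≤count t _ v) (m≤m+n _ _)
indicator≤count (t ⊕ c) p (inj₂ v) = ≤-trans (indicator≤count c _ v) (m≤n+m _ _)

1≤count : ∀ t (p : V t → Bool) → 1 ≤ count t p → ∃[ v ] p v ≡ true
1≤count •       p h with p tt in eq
... | true = tt , eq
1≤count (t ⊕ c) p h with count t (p ∘ inj₁) in eq
... | zero  = let v , q = 1≤count c (p ∘ inj₂) h in inj₂ v , q
... | suc _ = let v , q = 1≤count t (p ∘ inj₁) (subst (1 ≤_) (sym eq) (s≤s z≤n)) in inj₁ v , q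

2≤count : ∀ t (p : V t → Bool) → 2 ≤ count t p → ∃[ u ] ∃[ v ] u ≢ v × p u ≡ true × p v ≡ true
2≤count •       p h with s≤s () ← ≤-trans h (indicator≤1 (p tt))
2≤count (t ⊕ c) p h with count t (p ∘ inj₁) in eq
... | zero =
  let u , v , u≢v , q , r = 2≤count c (p ∘ inj₂) h
  in inj₂ u , inj₂ v , u≢v ∘ inj₂-injective , q , r
... | suc zero =
  let u , q = 1≤count t (p ∘ inj₁) (≤-reflexive (sym eq))
      v , r = 1≤count c (p ∘ inj₂) (case h of λ { (s≤s h′) → h′ })
  in inj₁ u , inj₂ v , (λ ()) , q , r
... | suc (suc _) =
  let u , v , u≢v , q , r = 2≤count t (p ∘ inj₁) (subst (2 ≤_) (sym eq) (s≤s (s≤s z≤n)))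
  in inj₁ u , inj₁ v , u≢v ∘ inj₁-injective , q , r

AtDistance2 : {A : Set} → (A → A → Bool) → A → A → Set
AtDistance2 E u w = (u ≢ w) × (E u w ≡ false) × (∃[ x ] (E u x ≡ true × E x w ≡ true))

Dominated : {A : Set} → (A → A → Bool) → (A → Bool) → A → Set
Dominated E S v =
  (∃[ u ] (S u ≡ true × E v u ≡ true))
  ⊎ (∃[ u ] ∃[ w ] (u ≢ w × S u ≡ true × S w ≡ true × AtDistance2 E v u × AtDistance2 E v w))

Dominated-Iso : {A B : Set} {E : A → A → Bool} {F : B → B → Bool} ((f , _) : Iso E F) (S : B → Bool) (v : A) →
  Dominated F S (Inverse.to f v) → Dominated E (S ∘ Inverse.to f) v
Dominated-Iso {A} {B} {E} {F} (f , p) S v = λ where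
    (inj₁ (u , s , e)) → inj₁ (from u , in-S s , edge e)
    (inj₂ (u , w , u≢w , s , s′ , d , d′)) →
      inj₂ (from u , from w , u≢w ∘ from-injective , in-S s , in-S s′ , dist2 d , dist2 d′)
  where
  open Inverse f using (to; from; strictlyInverseˡ)
  from-injective : ∀ {u w} → from u ≡ from w → u ≡ w
  from-injective {u} {w} eq = trans (sym (strictlyInverseˡ u)) (trans (cong to eq) (strictlyInverseˡ w))
  in-S : ∀ {u} → S u ≡ true → S (to (from u)) ≡ true
  in-S {u} = trans (cong S (strictlyInverseˡ u))
  edge : ∀ {x u b} → F (to x) u ≡ b → E x (from u) ≡ b
  edge {x} {u} = trans (trans (p x (from u)) (cong (F (to x)) (strictlyInverseˡ u)))
  dist2 : ∀ {u} → AtDistance2 F (to v) u → AtDistance2 E v (from u)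
  dist2 {u} (v≢u , e , x , e₁ , e₂) =
    (λ eq → v≢u (trans (cong to eq) (strictlyInverseˡ u))) , edge e , from x , edge e₁ ,
    edge (trans (cong (λ y → F y u) (strictlyInverseˡ x)) e₂)

-- Boolean, so that `far` can count. The mixed cases are the two ways in which a path of length 2
-- can cross the new edge.
dist2 : ∀ t → V t → V t → Bool
dist2 •       _        _        = false
dist2 (t ⊕ c) (inj₁ u) (inj₁ v) = dist2 t u v
dist2 (t ⊕ c) (inj₁ u) (inj₂ v) = (isRoot t u ∧ adj c (root c) v) ∨ (adj t u (root t) ∧ isRoot c v)
dist2 (t ⊕ c) (inj₂ u) (inj₁ v) = (isRoot c u ∧ adj t (root t) v) ∨ (adj c u (root c) ∧ isRoot t v)
dist2 (t ⊕ c) (inj₂ u) (inj₂ v) = dist2 c u v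

nonroot : ∀ t v → adj t (root t) v ≡ true → isRoot t v ≡ false
nonroot t v e with isRoot t v in r
... | false = refl
... | true with refl ← isRoot⇒≡ t v r = ⊥-elim (true≢false e (adj-irrefl t (root t)))

dist2-sound : ∀ t u v → dist2 t u v ≡ true → AtDistance2 (adj t) u v
dist2-sound (t ⊕ c) (inj₁ u) (inj₁ v) h =
  let u≢v , e , x , e₁ , e₂ = dist2-sound t u v h in (λ { refl → u≢v refl }) , e , inj₁ x , e₁ , e₂
dist2-sound (t ⊕ c) (inj₂ u) (inj₂ v) h =
  let u≢v , e , x , e₁ , e₂ = dist2-sound c u v h in (λ { refl → u≢v refl }) , e , inj₂ x , e₁ , e₂
dist2-sound (t ⊕ c) (inj₁ u) (inj₂ v) h with ∨-true {isRoot t u ∧ _} h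
... | inj₁ h′ = let r , e = ∧-true {isRoot t u} h′ in
  (λ ()) , cong₂ _∧_ r (nonroot c v e) , inj₂ (root c) , cong₂ _∧_ r (isRoot-root c) , e
... | inj₂ h′ = let e , r = ∧-true {adj t u (root t)} h′ in
  (λ ()) , cong₂ _∧_ (nonroot t u (trans (adj-sym t (root t) u) e)) r ,
  inj₁ (root t) , e , cong₂ _∧_ (isRoot-root t) r
dist2-sound (t ⊕ c) (inj₂ u) (inj₁ v) h with ∨-true {isRoot c u ∧ _} h
... | inj₁ h′ = let r , e = ∧-true {isRoot c u} h′ in
  (λ ()) , cong₂ _∧_ r (nonroot t v e) , inj₁ (root t) , cong₂ _∧_ r (isRoot-root t) , e
... | inj₂ h′ = let e , r = ∧-true {adj c u (root c)} h′ in
  (λ ()) , cong₂ _∧_ (nonroot c u (trans (adj-sym c (root c) u) e)) r ,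
  inj₂ (root c) , e , cong₂ _∧_ (isRoot-root c) r

near far : ∀ t → (V t → Bool) → V t → ℕ
near t S v = count t (λ w → adj t v w ∧ S w)
far  t S v = count t (λ w → dist2 t v w ∧ S w)

-- `b` is a debt in selected vertices at distance 2: `b = 0` implies domination, `b = 2` demands
-- nothing.
DominatedUpTo : ∀ t → (V t → Bool) → V t → ℕ → Set
DominatedUpTo t S v b = 1 ≤ near t S v ⊎ 2 ≤ far t S v + b

DominatedUpTo⇒Dominated : ∀ t S v → DominatedUpTo t S v 0 → Dominated (adj t) S v
DominatedUpTo⇒Dominated t S v (inj₁ h) with u , q ← 1≤count t _ h =
  let e , s = ∧-true {adj t v u} q in inj₁ (u , s , e)
DominatedUpTo⇒Dominated t S v (inj₂ h)
  with u , w , u≢w , q , r ← 2≤count t _ (subst (2 ≤_) (+-identityʳ _) h) =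
  let e , s = ∧-true {dist2 t v u} q ; e′ , s′ = ∧-true {dist2 t v w} r
  in inj₂ (u , w , u≢w , s , s′ , dist2-sound t v u e , dist2-sound t v w e′)

-- Partial domination across a new edge.

module _ (a b : RTree) (S : V b → Bool) (u : V a) where

  -- This bound and the next two serve both directions across the new edge, since the two mixed
  -- cases of `adj` and of `dist2` differ only by swapping the trees.
  cross-near : isRoot a u ≡ true →
    indicator (S (root b)) ≤ count b (λ w → (isRoot a u ∧ isRoot b w) ∧ S w)
  cross-near r rewrite r =
    ≤-trans (≤-reflexive (cong (λ x → indicator (x ∧ S (root b))) (sym (isRoot-root b))))
            (indicator≤count b (λ w → isRoot b w ∧ S w) (root b))

  private
    crossing : V b → Bool
    crossing w = ((isRoot a u ∧ adj b (root b) w) ∨ (adj a u (root a) ∧ isRoot b w)) ∧ S w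

  cross-far-root : isRoot a u ≡ true → near b S (root b) ≤ count b crossing
  cross-far-root r = count-mono b crosses
    where
    crosses : ∀ w → adj b (root b) w ∧ S w ≡ true → crossing w ≡ true
    crosses w q with e , s ← ∧-true {adj b (root b) w} q rewrite r | e = s

  cross-far-child : adj a u (root a) ≡ true → indicator (S (root b)) ≤ count b crossing
  cross-far-child e = ≤-trans (indicator-mono crosses) (indicator≤count b crossing (root b))
    where
    crosses : S (root b) ≡ true → crossing (root b) ≡ true
    crosses s rewrite e | isRoot-root b | s | ∨-zeroʳ (isRoot a u ∧ adj b (root b) (root b)) = refl

-- The lacks count missing selected vertices at distance 2; saving measures 2|t| + 2 − 3|S|, the 2
-- keeping it nonnegative.
record Guarantee : Set where
  constructor ⟨_,_,_,_∣_⟩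
  field
    rootSel kidsSel rootLack kidLack saving : ℕ

open Guarantee

record Realises (t : RTree) (S : V t → Bool) (g : Guarantee) : Set where
  field
    root-in     : rootSel g ≤ indicator (S (root t))
    children-in : kidsSel g ≤ near t S (root t)
    root-dom    : DominatedUpTo t S (root t) (rootLack g)
    child-dom   : ∀ v → adj t (root t) v ≡ true → DominatedUpTo t S v (kidLack g)
    deep-dom    : ∀ v → isRoot t v ≡ false → adj t (root t) v ≡ false → DominatedUpTo t S v 0
    cost        : 3 * count t S + saving g ≤ 2 * size t + 2

Has : RTree → Guarantee → Set
Has t g = ∃[ S ] Realises t S g

-- The summands 2 * rootSel implement "or that root is selected", as lacks never exceed 2.
record Achieves (g₁ g₂ g : Guarantee) : Set where
  constructor achieves
  field
    -- The children of the root of `c` end up too deep for later trees to help, so their lack is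
    -- settled now; their only gain at distance 2 is the root of `t`.
    grandchildren : kidLack g₂ ≤ rootSel g₁
    root-in       : rootSel g ≤ rootSel g₁
    children-in   : kidsSel g ≤ kidsSel g₁ + rootSel g₂
    root-dom      : rootLack g₁ ≤ rootLack g + kidsSel g₂ + 2 * rootSel g₂
    child-dom     : kidLack g₁ ≤ kidLack g + rootSel g₂
    new-child-dom : rootLack g₂ ≤ kidLack g + kidsSel g₁ + 2 * rootSel g₁
    -- The constant 2 inside `saving` occurs once for each part but only once for the whole.
    cost          : saving g + 2 ≤ saving g₁ + saving g₂

achieves? : ∀ g₁ g₂ g → Dec (Achieves g₁ g₂ g)
achieves? g₁ g₂ g = map′
  (λ (a , b , c , d , e , f , h) → achieves a b c d e f h)
  (λ (achieves a b c d e f h) → a , b , c , d , e , f , h)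
  (kidLack g₂ ≤? rootSel g₁ ×-dec
   rootSel g ≤? rootSel g₁ ×-dec
   kidsSel g ≤? kidsSel g₁ + rootSel g₂ ×-dec
   rootLack g₁ ≤? rootLack g + kidsSel g₂ + 2 * rootSel g₂ ×-dec
   kidLack g₁ ≤? kidLack g + rootSel g₂ ×-dec
   rootLack g₂ ≤? kidLack g + kidsSel g₁ + 2 * rootSel g₁ ×-dec
   saving g + 2 ≤? saving g₁ + saving g₂)

module _ {t c : RTree} {S₁ : V t → Bool} {S₂ : V c → Bool} {g₁ g₂ g : Guarantee}
  (r₁ : Realises t S₁ g₁) (r₂ : Realises c S₂ g₂) (a : Achieves g₁ g₂ g) where

  private
    module R₁ = Realises r₁
    module R₂ = Realises r₂
    module A = Achieves a

    S : V (t ⊕ c) → Bool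
    S = [ S₁ , S₂ ]

    -- `x` is a lower bound for the far count in the larger tree; the second inequality says that it
    -- makes up for lowering the lack from `b` to `b′`.
    upˡ : ∀ v {b b′} x → x ≤ far (t ⊕ c) S (inj₁ v) → far t S₁ v + b ≤ x + b′ →
      DominatedUpTo t S₁ v b → DominatedUpTo (t ⊕ c) S (inj₁ v) b′
    upˡ v x h h′ (inj₁ q) = inj₁ (≤-trans q (m≤m+n _ _))
    upˡ v x h h′ (inj₂ q) = inj₂ (≤-trans q (≤-trans h′ (+-monoˡ-≤ _ h)))

    upʳ : ∀ v {b b′} x → x ≤ far (t ⊕ c) S (inj₂ v) → far c S₂ v + b ≤ x + b′ →
      DominatedUpTo c S₂ v b → DominatedUpTo (t ⊕ c) S (inj₂ v) b′
    upʳ v x h h′ (inj₁ q) = inj₁ (≤-trans q (m≤n+m _ _))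
    upʳ v x h h′ (inj₂ q) = inj₂ (≤-trans q (≤-trans h′ (+-monoˡ-≤ _ h)))

    root-near : near t S₁ (root t) + rootSel g₂ ≤ near (t ⊕ c) S (inj₁ (root t))
    root-near = +-monoʳ-≤ _ (≤-trans R₂.root-in (cross-near t c S₂ (root t) (isRoot-root t)))

    new-near : rootSel g₁ ≤ near (t ⊕ c) S (inj₂ (root c))
    new-near = ≤-trans R₁.root-in (≤-trans (cross-near c t S₁ (root c) (isRoot-root c)) (m≤m+n _ _))

    regroup : ∀ x {y k m′ z} → y ≤ z + m′ + 2 * 0 → m′ ≤ k → x + y ≤ (x + k) + z
    regroup x {y} {k} {m′} {z} h h′ = begin
      x + y              ≤⟨ +-monoʳ-≤ x h ⟩
      x + (z + m′ + 0)   ≡⟨ solve 3 (λ x z m → x :+ (z :+ m :+ con 0) := x :+ m :+ z) refl x z m′ ⟩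
      x + m′ + z         ≤⟨ +-monoˡ-≤ z (+-monoʳ-≤ x h′) ⟩
      x + k + z          ∎
      where
      open ≤-Reasoning
      open +-*-Solver

    -- A selected new child is adjacent to the root; otherwise the selected children of the new
    -- child add to the count at distance 2.
    root-dom′ : DominatedUpTo (t ⊕ c) S (inj₁ (root t)) (rootLack g)
    root-dom′ with rootSel g₂ | root-near | A.root-dom
    ... | suc _ | h | _ = inj₁ (≤-trans (≤-trans (s≤s z≤n) (m≤n+m _ _)) h)
    ... | zero  | _ | h = upˡ (root t) _ (+-monoʳ-≤ _ (cross-far-root t c S₂ (root t) (isRoot-root t)))
      (regroup _ h R₂.children-in) R₁.root-dom

    -- Seen from the new child, the root of `t` is adjacent and the selected siblings lie at
    -- distance 2.
    new-child-dom′ : DominatedUpTo (t ⊕ c) S (inj₂ (root c)) (kidLack g)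
    new-child-dom′ with rootSel g₁ | new-near | A.new-child-dom
    ... | suc _ | h | _ = inj₁ (≤-trans (s≤s z≤n) h)
    ... | zero  | _ | h = upʳ (root c) _
      (≤-trans (≤-reflexive (+-comm _ (near t S₁ (root t))))
               (+-monoˡ-≤ _ (cross-far-root c t S₁ (root c) (isRoot-root c))))
      (regroup _ h R₁.children-in) R₂.root-dom

    child-dom′ : ∀ v → adj (t ⊕ c) (inj₁ (root t)) v ≡ true → DominatedUpTo (t ⊕ c) S v (kidLack g)
    child-dom′ (inj₁ v) e = upˡ v _
      (+-monoʳ-≤ _ (≤-trans R₂.root-in (cross-far-child t c S₂ v (trans (adj-sym t v (root t)) e))))
      (≤-trans (+-monoʳ-≤ _ A.child-dom) (≤-reflexive
        (trans (cong (far t S₁ v +_) (+-comm (kidLack g) _)) (sym (+-assoc _ (rootSel g₂) (kidLack g))))))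
      (R₁.child-dom v e)
    child-dom′ (inj₂ v) e with refl ← isRoot⇒≡ c v (proj₂ (∧-true {isRoot t (root t)} e)) = new-child-dom′

    deep-dom′ : ∀ v → isRoot (t ⊕ c) v ≡ false → adj (t ⊕ c) (inj₁ (root t)) v ≡ false →
      DominatedUpTo (t ⊕ c) S v 0
    deep-dom′ (inj₁ v) r e = upˡ v _ (m≤m+n _ _) ≤-refl (R₁.deep-dom v r e)
    deep-dom′ (inj₂ v) _ e with true⊎false (isRoot c v) | true⊎false (adj c (root c) v)
    ... | inj₁ r | _       = ⊥-elim (true≢false (cong₂ _∧_ (isRoot-root t) r) e)
    ... | inj₂ r | inj₂ e′ = upʳ v _ (m≤n+m _ _) ≤-refl (R₂.deep-dom v r e′)
    ... | inj₂ _ | inj₁ e′ = upʳ v _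
      (≤-trans (≤-reflexive (+-comm (far c S₂ v) (rootSel g₁)))
               (+-monoˡ-≤ _ (≤-trans R₁.root-in (cross-far-child c t S₁ v (trans (adj-sym c v (root c)) e′)))))
      (≤-trans (+-monoʳ-≤ (far c S₂ v) A.grandchildren) (≤-reflexive (sym (+-identityʳ _))))
      (R₂.child-dom v e′)

    cost′ : 3 * count (t ⊕ c) S + saving g ≤ 2 * size (t ⊕ c) + 2
    cost′ = +-cancelʳ-≤ 2 _ _ (begin
      3 * (k₁ + k₂) + saving g + 2                   ≡⟨ +-assoc (3 * (k₁ + k₂)) _ _ ⟩
      3 * (k₁ + k₂) + (saving g + 2)                 ≤⟨ +-monoʳ-≤ (3 * (k₁ + k₂)) A.cost ⟩
      3 * (k₁ + k₂) + (saving g₁ + saving g₂)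
        ≡⟨ solve 4 (λ k₁ k₂ p₁ p₂ →
             con 3 :* (k₁ :+ k₂) :+ (p₁ :+ p₂) := (con 3 :* k₁ :+ p₁) :+ (con 3 :* k₂ :+ p₂))
             refl k₁ k₂ (saving g₁) (saving g₂) ⟩
      (3 * k₁ + saving g₁) + (3 * k₂ + saving g₂)         ≤⟨ +-mono-≤ R₁.cost R₂.cost ⟩
      (2 * size t + 2) + (2 * size c + 2)
        ≡⟨ solve 2 (λ x y →
             (con 2 :* x :+ con 2) :+ (con 2 :* y :+ con 2) := con 2 :* (x :+ y) :+ con 2 :+ con 2)
             refl (size t) (size c) ⟩
      2 * (size t + size c) + 2 + 2             ∎)
      where
      open ≤-Reasoning
      open +-*-Solver
      k₁ = count t S₁
      k₂ = count c S₂

  Realises-⊕ : Realises (t ⊕ c) S g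
  Realises-⊕ = record
    { root-in     = ≤-trans A.root-in R₁.root-in
    ; children-in = ≤-trans A.children-in (≤-trans (+-monoˡ-≤ _ R₁.children-in) root-near)
    ; root-dom    = root-dom′
    ; child-dom   = child-dom′
    ; deep-dom    = deep-dom′
    ; cost        = cost′
    }

Has-⊕ : ∀ {t c g₁ g₂ g} → Has t g₁ → Has c g₂ → Achieves g₁ g₂ g → Has (t ⊕ c) g
Has-⊕ (_ , r₁) (_ , r₂) a = _ , Realises-⊕ r₁ r₂ a

Realises⇒Dominated : ∀ {t S g} → Realises t S g → rootLack g ≡ 0 → kidLack g ≡ 0 → ∀ v → Dominated (adj t) S v
Realises⇒Dominated {t} {S} {g} r refl refl v = DominatedUpTo⇒Dominated t S v dom
  where
  open Realises r
  dom : DominatedUpTo t S v 0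
  dom with true⊎false (isRoot t v) | true⊎false (adj t (root t) v)
  ... | inj₁ r′ | _      = subst (λ v → DominatedUpTo t S v 0) (sym (isRoot⇒≡ t v r′)) root-dom
  ... | inj₂ _  | inj₁ e = child-dom v e
  ... | inj₂ r′ | inj₂ e = deep-dom v r′ e

-- Extremal trees and their parts as rooted trees.

P₂ leg cherry : RTree
P₂     = • ⊕ •
leg    = • ⊕ P₂
cherry = P₂ ⊕ •

legs : ℕ → RTree → RTree
legs zero    t = t
legs (suc k) t = legs k t ⊕ leg

spider : ℕ → RTree
spider k = legs k •

-- The smallest member of the family `F`, rooted at the centre `v`. The root of `leg ⊕ leg` is `w`,
-- and the `leg` hung there is the one that was moved.
F₂ : RTree
F₂ = • ⊕ (leg ⊕ leg)

legs-⊕ : ∀ k t c → legs k t ⊕ c ≈ legs k (t ⊕ c)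
legs-⊕ zero    t c = ≈-refl
legs-⊕ (suc k) t c = ≈-trans (⊕-exchange (legs k t) leg c) (⊕-congˡ (legs-⊕ k t c))

-- The index shifts build in the ranges of the families: `isT k` is the tree with `k + 1` legs,
-- `isF k` the member of `F` with index `k + 2`.
data Extremal (t : RTree) : Set where
  isT  : ∀ k → t ~ spider (suc k) → Extremal t
  isF  : ∀ k → t ~ legs k F₂ → Extremal t
  isK  : t ~ cherry ⊕ • → Extremal t
  isT* : t ~ • ⊕ cherry ⊕ leg → Extremal t

Extremal-resp : ∀ {t u} → t ~ u → Extremal u → Extremal t
Extremal-resp p (isT k q) = isT k (~-trans p q)
Extremal-resp p (isF k q) = isF k (~-trans p q)
Extremal-resp p (isK q)   = isK (~-trans p q)
Extremal-resp p (isT* q)  = isT* (~-trans p q)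

exchange : ∀ t a b → Extremal (t ⊕ b ⊕ a) → Extremal (t ⊕ a ⊕ b)
exchange t a b = Extremal-resp (unrooted (⊕-exchange t a b))

exchangeˡ : ∀ t a b c → Extremal (t ⊕ b ⊕ a ⊕ c) → Extremal (t ⊕ a ⊕ b ⊕ c)
exchangeˡ t a b c = Extremal-resp (unrooted (⊕-congˡ (⊕-exchange t a b)))

commute : ∀ t c → Extremal (c ⊕ t) → Extremal (t ⊕ c)
commute t c = Extremal-resp (⊕-comm t c)

-- This is the member of `F` with index `k + 2`, seen from `w`, where the branches `P₂`, `leg` and
-- `spider k` meet. The next four lemmas give other orders of hanging these branches that the
-- composition rules meet; for `k = 0` the last branch is a leaf.
twinLegs-spider : ∀ k → Extremal (leg ⊕ leg ⊕ spider k)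
twinLegs-spider k = isF k (~-trans (⊕-comm (leg ⊕ leg) (spider k)) (unrooted (legs-⊕ k • (leg ⊕ leg))))

leg-spider-leg : ∀ k → Extremal (leg ⊕ spider k ⊕ leg)
leg-spider-leg k = exchange leg (spider k) leg (twinLegs-spider k)

spider-P₂-leg : ∀ k → Extremal (• ⊕ spider k ⊕ P₂ ⊕ leg)
spider-P₂-leg k = exchangeˡ • (spider k) P₂ leg (leg-spider-leg k)

leg-spider-P₂ : ∀ k → Extremal (• ⊕ leg ⊕ spider k ⊕ P₂)
leg-spider-P₂ k = exchange (• ⊕ leg) (spider k) P₂ (exchangeˡ • leg P₂ (spider k) (twinLegs-spider k))

spider-leg-P₂ : ∀ k → Extremal (• ⊕ spider k ⊕ leg ⊕ P₂)
spider-leg-P₂ k = exchangeˡ • (spider k) leg P₂ (leg-spider-P₂ k)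

-- A spider with `k + 1` legs, seen from the middle vertex of one leg, with the end of that leg hung
-- last.
spider-vertex : ∀ k → Extremal (• ⊕ (• ⊕ spider k) ⊕ •)
spider-vertex k = exchange • (• ⊕ spider k) • (commute P₂ (• ⊕ spider k)
  (exchange • (spider k) P₂ (isT k (⊕-comm leg (spider k)))))

-- The tree `T*` seen from its vertex of degree 3, with one of the adjacent leaves hung last.
cherry-vertex : Extremal (P₂ ⊕ (• ⊕ leg) ⊕ •)
cherry-vertex = exchange P₂ (• ⊕ leg) • (isT* (⊕-rotate cherry • leg))

-- The first thirteen shapes describe parts of extremal trees or of P₅ and P₆; trees of the slack
-- shapes are too cheap to be part of an extremal tree.
data Shape : Set where
  single edge leg₁ cherry₁ spider₁ arm₁ spider₂₊ arm₂₊ lacksLeg twinLegs lacksEdge lacksVertex spiderF : Shape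
  slack₁ slack₂ slack₃ slack₄ slack₅ : Shape

-- Equality where only one order of building occurs, `≈` where several orders meet, and an extremal
-- completion where different trees share the same guarantees.
Fits : Shape → RTree → Set
Fits single      t = t ≡ •
Fits edge        t = t ≡ P₂
Fits leg₁        t = t ≡ leg
Fits cherry₁     t = t ≡ cherry
Fits spider₁     t = t ≡ spider 1
Fits arm₁        t = t ≡ • ⊕ spider 1
Fits spider₂₊    t = ∃[ k ] t ≡ spider (2 + k)
Fits arm₂₊       t = ∃[ k ] t ≡ • ⊕ spider (2 + k)
Fits lacksLeg    t = Extremal (t ⊕ leg)
Fits twinLegs    t = t ≈ leg ⊕ leg
Fits lacksEdge   t = Extremal (t ⊕ P₂)
Fits lacksVertex t = Extremal (t ⊕ •)
Fits spiderF     t = ∃[ k ] t ≈ legs k F₂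
Fits _           t = ⊤

-- Found by closing the optimal guarantees of the parts of extremal trees under ⊕, then discarding
-- guarantees as long as the closure property persists.
guarantees : Shape → List Guarantee
guarantees single      = ⟨ 0 , 0 , 2 , 0 ∣ 4 ⟩ ∷ ⟨ 1 , 0 , 2 , 0 ∣ 1 ⟩ ∷ []
guarantees edge        = ⟨ 0 , 0 , 2 , 2 ∣ 6 ⟩ ∷ ⟨ 1 , 0 , 2 , 0 ∣ 3 ⟩ ∷ ⟨ 1 , 1 , 0 , 0 ∣ 0 ⟩ ∷ []
guarantees leg₁        = ⟨ 0 , 1 , 0 , 2 ∣ 5 ⟩ ∷ ⟨ 1 , 1 , 0 , 0 ∣ 2 ⟩ ∷ []
guarantees cherry₁     = ⟨ 1 , 0 , 2 , 0 ∣ 5 ⟩ ∷ []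
guarantees spider₁     = ⟨ 0 , 1 , 0 , 0 ∣ 4 ⟩ ∷ ⟨ 1 , 1 , 0 , 0 ∣ 1 ⟩ ∷ []
guarantees arm₁        = ⟨ 0 , 0 , 1 , 0 ∣ 6 ⟩ ∷ ⟨ 0 , 1 , 0 , 0 ∣ 3 ⟩ ∷ ⟨ 1 , 0 , 1 , 0 ∣ 3 ⟩ ∷ []
guarantees spider₂₊    = ⟨ 0 , 2 , 0 , 0 ∣ 4 ⟩ ∷ ⟨ 1 , 2 , 0 , 0 ∣ 1 ⟩ ∷ []
guarantees arm₂₊       = ⟨ 0 , 0 , 0 , 0 ∣ 6 ⟩ ∷ ⟨ 1 , 0 , 0 , 0 ∣ 3 ⟩ ∷ []
guarantees lacksLeg    = ⟨ 0 , 1 , 0 , 2 ∣ 7 ⟩ ∷ ⟨ 1 , 1 , 0 , 0 ∣ 4 ⟩ ∷ []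
guarantees twinLegs    = ⟨ 0 , 2 , 0 , 1 ∣ 5 ⟩ ∷ ⟨ 1 , 2 , 0 , 0 ∣ 2 ⟩ ∷ []
guarantees lacksEdge   = ⟨ 0 , 1 , 0 , 1 ∣ 6 ⟩ ∷ ⟨ 1 , 1 , 0 , 0 ∣ 3 ⟩ ∷ []
guarantees lacksVertex = ⟨ 0 , 0 , 1 , 0 ∣ 5 ⟩ ∷ ⟨ 1 , 0 , 2 , 0 ∣ 5 ⟩ ∷ []
guarantees spiderF     = ⟨ 1 , 0 , 0 , 0 ∣ 4 ⟩ ∷ []
guarantees slack₁      = ⟨ 0 , 2 , 0 , 1 ∣ 6 ⟩ ∷ ⟨ 1 , 2 , 0 , 0 ∣ 3 ⟩ ∷ []
guarantees slack₂      = ⟨ 0 , 2 , 0 , 0 ∣ 5 ⟩ ∷ ⟨ 1 , 2 , 0 , 0 ∣ 2 ⟩ ∷ []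
guarantees slack₃      = ⟨ 1 , 0 , 2 , 0 ∣ 6 ⟩ ∷ []
guarantees slack₄      = ⟨ 0 , 0 , 2 , 1 ∣ 7 ⟩ ∷ ⟨ 1 , 0 , 0 , 0 ∣ 4 ⟩ ∷ []
guarantees slack₅      = ⟨ 1 , 0 , 0 , 0 ∣ 5 ⟩ ∷ []

Composes : Shape → Shape → Shape → Set
Composes i j k = ∀ {t c} → Fits i t → Fits j c → Fits k (t ⊕ c)

-- A pair without a rule yields a tree cheap enough to be slack. It may still be a complete extremal
-- tree: `cherry₁` with `single` gives the star rooted at its centre, which can never be the part
-- below a leaf of an extremal tree.
rule : ∀ i j → Maybe (∃[ k ] Composes i j k)
rule single   single    = just (edge        , λ { refl refl → refl })
rule single   edge      = just (leg₁        , λ { refl refl → refl })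
rule single   leg₁      = just (spider₁     , λ { refl refl → refl })
rule single   cherry₁   = just (lacksLeg    , λ { refl refl → isT* ~-refl })
rule single   spider₁   = just (arm₁        , λ { refl refl → refl })
rule single   arm₁      = just (lacksVertex , λ { refl refl → spider-vertex 1 })
rule single   spider₂₊  = just (arm₂₊       , λ { refl (k , refl) → k , refl })
rule single   arm₂₊     = just (lacksVertex , λ { refl (k , refl) → spider-vertex (2 + k) })
rule single   lacksLeg  = just (lacksEdge   , λ { {c = c} refl e → exchange • c P₂ (commute leg c e) })
rule single   twinLegs  = just (spiderF     , λ { refl e → 0 , ⊕-congʳ e })
rule single   lacksEdge = just (lacksVertex , λ { {c = c} refl e → exchange • c • (commute P₂ c e) })
rule single   spiderF   = just (lacksEdge   , λ { {c = c} refl (k , e) →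
  exchange • c P₂ (commute leg c (isF (suc k) (unrooted (⊕-congˡ e)))) })
rule edge     single    = just (cherry₁     , λ { refl refl → refl })
rule edge     edge      = just (lacksLeg    , λ { refl refl → spider-P₂-leg 0 })
rule edge     leg₁      = just (lacksEdge   , λ { refl refl → spider-leg-P₂ 0 })
rule edge     spider₁   = just (lacksVertex , λ { refl refl → cherry-vertex })
rule leg₁     single    = just (lacksLeg    , λ { refl refl → leg-spider-leg 0 })
rule leg₁     leg₁      = just (twinLegs    , λ { refl refl → ≈-refl })
rule leg₁     spider₁   = just (lacksLeg    , λ { refl refl → leg-spider-leg 1 })
rule leg₁     spider₂₊  = just (lacksLeg    , λ { refl (k , refl) → leg-spider-leg (2 + k) })
rule spider₁  single    = just (lacksEdge   , λ { refl refl → leg-spider-P₂ 0 })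
rule spider₁  edge      = just (twinLegs    , λ { refl refl → ⊕-exchange • leg P₂ })
rule spider₁  leg₁      = just (spider₂₊    , λ { refl refl → 0 , refl })
rule spider₁  spider₁   = just (lacksEdge   , λ { refl refl → leg-spider-P₂ 1 })
rule spider₁  spider₂₊  = just (lacksEdge   , λ { refl (k , refl) → leg-spider-P₂ (2 + k) })
rule spider₁  twinLegs  = just (spiderF     , λ { refl e → 1 , ≈-trans (⊕-congʳ e) (legs-⊕ 1 • _) })
rule arm₁     single    = just (lacksVertex , λ { refl refl → exchangeˡ • (spider 1) • • cherry-vertex })
rule arm₁     edge      = just (lacksLeg    , λ { refl refl → spider-P₂-leg 1 })
rule arm₁     leg₁      = just (lacksEdge   , λ { refl refl → spider-leg-P₂ 1 })
-- A leg with two selected vertices pays `3 * 2` for `2 * 3`, so the saving is the same for every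
-- number of legs; from two on, so is the useful number of selected children.
rule spider₂₊ leg₁      = just (spider₂₊    , λ { (k , refl) refl → suc k , refl })
rule spider₂₊ twinLegs  = just (spiderF     , λ { (k , refl) e → 2 + k , ≈-trans (⊕-congʳ e) (legs-⊕ (2 + k) • _) })
rule arm₂₊    edge      = just (lacksLeg    , λ { (k , refl) refl → spider-P₂-leg (2 + k) })
rule arm₂₊    leg₁      = just (lacksEdge   , λ { (k , refl) refl → spider-leg-P₂ (2 + k) })
rule spiderF  leg₁      = just (spiderF     , λ { (k , e) refl → suc k , ⊕-congˡ e })
rule _        _         = nothing

-- Fitting a slack shape is no condition, so any of the five whose guarantees can be covered will
-- do.
slackRules : ∀ i j → List (∃[ k ] Composes i j k)
slackRules i j =
  (slack₁ , λ _ _ → tt) ∷ (slack₂ , λ _ _ → tt) ∷ (slack₃ , λ _ _ → tt) ∷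
  (slack₄ , λ _ _ → tt) ∷ (slack₅ , λ _ _ → tt) ∷ []

candidates : ∀ i j → List (∃[ k ] Composes i j k)
candidates i j with rule i j
... | just r  = r ∷ []
... | nothing = slackRules i j

-- Closure of the shapes under hanging, decided by evaluation.

Covers : Shape → Shape → List Guarantee → Set
Covers i j = All λ g → Any (λ g₁ → Any (λ g₂ → Achieves g₁ g₂ g) (guarantees j)) (guarantees i)

covers? : ∀ i j gs → Dec (Covers i j gs)
covers? i j = All.all? λ g → Any.any? (λ g₁ → Any.any? (λ g₂ → achieves? g₁ g₂ g) (guarantees j)) (guarantees i)

shapes : List Shape
shapes =
  single ∷ edge ∷ leg₁ ∷ cherry₁ ∷ spider₁ ∷ arm₁ ∷ spider₂₊ ∷ arm₂₊ ∷ lacksLeg ∷ twinLegs ∷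
  lacksEdge ∷ lacksVertex ∷ spiderF ∷ slack₁ ∷ slack₂ ∷ slack₃ ∷ slack₄ ∷ slack₅ ∷ []

∈-shapes : ∀ i → i ∈ shapes
∈-shapes single      = ∈-lookup {xs = shapes} (# 0)
∈-shapes edge        = ∈-lookup {xs = shapes} (# 1)
∈-shapes leg₁        = ∈-lookup {xs = shapes} (# 2)
∈-shapes cherry₁     = ∈-lookup {xs = shapes} (# 3)
∈-shapes spider₁     = ∈-lookup {xs = shapes} (# 4)
∈-shapes arm₁        = ∈-lookup {xs = shapes} (# 5)
∈-shapes spider₂₊    = ∈-lookup {xs = shapes} (# 6)
∈-shapes arm₂₊       = ∈-lookup {xs = shapes} (# 7)
∈-shapes lacksLeg    = ∈-lookup {xs = shapes} (# 8)
∈-shapes twinLegs    = ∈-lookup {xs = shapes} (# 9)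
∈-shapes lacksEdge   = ∈-lookup {xs = shapes} (# 10)
∈-shapes lacksVertex = ∈-lookup {xs = shapes} (# 11)
∈-shapes spiderF     = ∈-lookup {xs = shapes} (# 12)
∈-shapes slack₁      = ∈-lookup {xs = shapes} (# 13)
∈-shapes slack₂      = ∈-lookup {xs = shapes} (# 14)
∈-shapes slack₃      = ∈-lookup {xs = shapes} (# 15)
∈-shapes slack₄      = ∈-lookup {xs = shapes} (# 16)
∈-shapes slack₅      = ∈-lookup {xs = shapes} (# 17)

closed? : Dec (All (λ i → All (λ j → Any (λ (k , _) → Covers i j (guarantees k)) (candidates i j)) shapes) shapes)
closed? = All.all? (λ i → All.all? (λ j →
  Any.any? (λ (k , _) → covers? i j (guarantees k)) (candidates i j)) shapes) shapes

-- Abstract because normalising this evidence is prohibitively expensive.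
abstract
  closed : ∀ i j → Any (λ (k , _) → Covers i j (guarantees k)) (candidates i j)
  closed i j = All.lookup (All.lookup (toWitness {a? = closed?} tt) (∈-shapes i)) (∈-shapes j)

single-guarantees : All (Has •) (guarantees single)
single-guarantees = (_ , outside) ∷ (_ , inside) ∷ []
  where
  outside : Realises • (λ _ → false) ⟨ 0 , 0 , 2 , 0 ∣ 4 ⟩
  outside = record
    { root-in = z≤n ; children-in = z≤n ; root-dom = inj₂ ≤-refl
    ; child-dom = λ _ () ; deep-dom = λ _ () ; cost = ≤-refl }
  inside : Realises • (λ _ → true) ⟨ 1 , 0 , 2 , 0 ∣ 1 ⟩
  inside = record
    { root-in = ≤-refl ; children-in = z≤n ; root-dom = inj₂ ≤-refl
    ; child-dom = λ _ () ; deep-dom = λ _ () ; cost = ≤-refl }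

compose : ∀ {i j t c gs} → All (Has t) (guarantees i) → All (Has c) (guarantees j) →
  Covers i j gs → All (Has (t ⊕ c)) gs
compose hs hs′ = All.map λ g →
  let h , h″ = All.lookupAny hs g ; h′ , a = All.lookupAny hs′ h″ in Has-⊕ h h′ a

classify : ∀ t → ∃[ i ] Fits i t × All (Has t) (guarantees i)
classify •       = single , refl , single-guarantees
classify (t ⊕ c) =
  let i , f , hs = classify t
      j , f′ , hs′ = classify c
      (k , fits) , covers = Any.satisfied (closed i j)
  in k , fits f f′ , compose hs hs′ covers

-- The tree below a leaf.

HasDTD : RTree → ℕ → Set
HasDTD t p = Has t ⟨ 0 , 0 , 0 , 0 ∣ p ⟩

-- For `• ⊕ c` of order `m`, saving 4 means `3|S| + 4 ≤ 2m + 2`, which is the bound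
-- `3|S| ≤ 2(m - 1)`; saving 5 makes it strict. The first three cases are ruled out by the
-- hypotheses on the tree.
data Verdict (c : RTree) : Set where
  tiny   : size c ≤ 2 → Verdict c
  path₅  : c ≡ spider 1 → Verdict c
  path₆  : c ≡ • ⊕ spider 1 → Verdict c
  tight  : HasDTD (• ⊕ c) 4 → Extremal (• ⊕ c) → Verdict c
  strict : HasDTD (• ⊕ c) 5 → Verdict c

verdict : ∀ c → Verdict c
verdict c with classify c
... | i , f , hs = go i f hs
  where
  saves : ∀ i {p} → All (Has c) (guarantees i) →
    {True (covers? single i (⟨ 0 , 0 , 0 , 0 ∣ p ⟩ ∷ []))} → HasDTD (• ⊕ c) p
  saves i hs {w} = All.head (compose {single} {i} single-guarantees hs (toWitness w))
  go : ∀ i → Fits i c → All (Has c) (guarantees i) → Verdict c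
  go single      refl hs = tiny (s≤s z≤n)
  go edge        refl hs = tiny ≤-refl
  go leg₁        refl hs = tight (saves leg₁ hs) (isT 0 ~-refl)
  go cherry₁     refl hs = tight (saves cherry₁ hs) (isK (⊕-comm • cherry))
  go spider₁     f    hs = path₅ f
  go arm₁        f    hs = path₆ f
  go spider₂₊    f    hs = strict (saves spider₂₊ hs)
  go arm₂₊       f    hs = strict (saves arm₂₊ hs)
  go lacksLeg    f    hs = strict (saves lacksLeg hs)
  go twinLegs    f    hs = tight (saves twinLegs hs) (isF 0 (unrooted (⊕-congʳ f)))
  go lacksEdge   f    hs = strict (saves lacksEdge hs)
  go lacksVertex f    hs = tight (saves lacksVertex hs) (commute • c f)
  go spiderF     f    hs = strict (saves spiderF hs)
  go slack₁      f    hs = strict (saves slack₁ hs)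
  go slack₂      f    hs = strict (saves slack₂ hs)
  go slack₃      f    hs = strict (saves slack₃ hs)
  go slack₄      f    hs = strict (saves slack₄ hs)
  go slack₅      f    hs = strict (saves slack₅ hs)

-- Lower bounds

record PendantPath {A : Set} (E : A → A → Bool) (α β γ : A) : Set where
  field
    β-nbr : ∀ u → E β u ≡ true → u ≡ α ⊎ u ≡ γ
    γ-nbr : ∀ u → E γ u ≡ true → u ≡ β

module _ {A : Set} {E : A → A → Bool} {S : A → Bool} {α β γ : A} (path : PendantPath E α β γ) where

  open PendantPath path

  -- From `γ` two steps lead through `β` to `α` or back, so there are never two vertices at distance
  -- 2 and `γ` needs its only possible neighbour.
  β∈S : Dominated E S γ → S β ≡ true
  β∈S (inj₁ (u , s , e)) with refl ← γ-nbr u e = s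
  β∈S (inj₂ (u , w , u≢w , _ , _ , du , dw)) = contradiction (trans (only-α du) (sym (only-α dw))) u≢w
    where
    only-α : ∀ {u} → AtDistance2 E γ u → u ≡ α
    only-α {u} (γ≢u , _ , x , e₁ , e₂) with refl ← γ-nbr x e₁ with β-nbr u e₂
    ... | inj₁ eq = eq
    ... | inj₂ eq = contradiction (sym eq) γ≢u

  BeyondPath : A → Set
  BeyondPath u = S u ≡ true × E α u ≡ true × u ≢ β

  -- Vertices at distance 2 from `β` are reached through `α`, because a walk through `γ` returns to
  -- `β`.
  α∈S⊎γ∈S : Dominated E S β →
    (S α ≡ true ⊎ S γ ≡ true) ⊎ (∃[ u ] ∃[ w ] u ≢ w × BeyondPath u × BeyondPath w)
  α∈S⊎γ∈S (inj₁ (u , s , e)) with β-nbr u e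
  ... | inj₁ refl = inj₁ (inj₁ s)
  ... | inj₂ refl = inj₁ (inj₂ s)
  α∈S⊎γ∈S (inj₂ (u , w , u≢w , s , s′ , du , dw)) = inj₂ (u , w , u≢w , beyond s du , beyond s′ dw)
    where
    beyond : ∀ {u} → S u ≡ true → AtDistance2 E β u → BeyondPath u
    beyond {u} s (β≢u , _ , x , e₁ , e₂) with β-nbr x e₁
    ... | inj₁ refl = s , e₂ , β≢u ∘ sym
    ... | inj₂ refl = contradiction (sym (γ-nbr u e₂)) β≢u

pattern ℓ₁ = inj₁ tt
pattern ℓ₂ = inj₂ (inj₁ tt)
pattern ℓ₃ = inj₂ (inj₂ tt)

2≤count-leg : ∀ S → S ℓ₂ ≡ true → S ℓ₁ ≡ true ⊎ S ℓ₃ ≡ true → 2 ≤ count leg S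
2≤count-leg S b (inj₁ a) rewrite a | b = s≤s (s≤s z≤n)
2≤count-leg S b (inj₂ c) rewrite b | c = ≤-trans (s≤s (s≤s z≤n)) (m≤n+m 2 _)

leg-path : ∀ t → PendantPath (adj (t ⊕ leg)) (inj₂ ℓ₁) (inj₂ ℓ₂) (inj₂ ℓ₃)
leg-path t = record
  { β-nbr = λ { (inj₁ _) () ; (inj₂ ℓ₁) _ → inj₁ refl ; (inj₂ ℓ₂) () ; (inj₂ ℓ₃) _ → inj₂ refl }
  ; γ-nbr = λ { (inj₁ _) () ; (inj₂ ℓ₁) () ; (inj₂ ℓ₂) _ → refl ; (inj₂ ℓ₃) () }
  }

-- Beyond the leg, `α` is adjacent to the root of `t` alone, so the exceptional case with two
-- selected vertices beyond the path cannot occur.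
leg-lower : ∀ t (S : V (t ⊕ leg) → Bool) →
  Dominated (adj (t ⊕ leg)) S (inj₂ ℓ₂) → Dominated (adj (t ⊕ leg)) S (inj₂ ℓ₃) → 2 ≤ count leg (S ∘ inj₂)
leg-lower t S d₂ d₃ = [ 2≤count-leg (S ∘ inj₂) (β∈S (leg-path t) d₃) , two-beyond ] (α∈S⊎γ∈S (leg-path t) d₂)
  where
  only-root : ∀ {u} → BeyondPath {S = S} (leg-path t) u → u ≡ inj₁ (root t)
  only-root {inj₁ u}  (_ , e , _)  = cong inj₁ (isRoot⇒≡ t u e)
  only-root {inj₂ ℓ₂} (_ , _ , ≢ℓ₂) = contradiction refl ≢ℓ₂
  two-beyond : (∃[ u ] ∃[ w ] u ≢ w × BeyondPath {S = S} (leg-path t) u × BeyondPath {S = S} (leg-path t) w) →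
    2 ≤ count leg (S ∘ inj₂)
  two-beyond (_ , _ , u≢w , bu , bw) = contradiction (trans (only-root bu) (sym (only-root bw))) u≢w

-- Nothing hung below the root comes within distance 2 of a vertex at depth at least 2, so this
-- condition survives when legs are removed one by one.
DeepDominated : ∀ t → (V t → Bool) → Set
DeepDominated t S = ∀ v → isRoot t v ≡ false → adj t v (root t) ≡ false → Dominated (adj t) S v

DeepDominated-⊕ˡ : ∀ t c S → DeepDominated (t ⊕ c) S → DeepDominated t (S ∘ inj₁)
DeepDominated-⊕ˡ t c S dom v r e = restrict (dom (inj₁ v) r e)
  where
  inside : ∀ {u} → AtDistance2 (adj (t ⊕ c)) (inj₁ v) u → ∃[ u′ ] u ≡ inj₁ u′ × AtDistance2 (adj t) v u′
  inside {inj₁ u} (v≢u , e , inj₁ x , e₁ , e₂) = u , refl , v≢u ∘ cong inj₁ , e , x , e₁ , e₂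
  inside {inj₂ u} (_ , _ , inj₁ x , e₁ , e₂) with refl ← isRoot⇒≡ t x (proj₁ (∧-true {isRoot t x} e₂)) =
    ⊥-elim (true≢false e₁ e)
  inside (_ , _ , inj₂ x , e₁ , _) = ⊥-elim (true≢false (proj₁ (∧-true {isRoot t v} e₁)) r)
  restrict : Dominated (adj (t ⊕ c)) S (inj₁ v) → Dominated (adj t) (S ∘ inj₁) v
  restrict (inj₁ (inj₁ u , s , e′)) = inj₁ (u , s , e′)
  restrict (inj₁ (inj₂ u , s , e′)) = ⊥-elim (true≢false (proj₁ (∧-true {isRoot t v} e′)) r)
  restrict (inj₂ (u , w , u≢w , s , s′ , du , dw)) with inside du | inside dw
  ... | u′ , refl , du′ | w′ , refl , dw′ = inj₂ (u′ , w′ , u≢w ∘ cong inj₁ , s , s′ , du′ , dw′)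

-- Each leg forces two selected vertices of its own, on top of the `b` forced by the core.
legs-lower : ∀ t b → (∀ S → DeepDominated t S → b ≤ count t S) →
  ∀ k S → DeepDominated (legs k t) S → b + k * 2 ≤ count (legs k t) S
legs-lower t b h zero    S dom = subst (_≤ count t S) (sym (+-identityʳ b)) (h S dom)
legs-lower t b h (suc k) S dom = begin
  b + (2 + k * 2)   ≡⟨ solve 2 (λ b k → b :+ (con 2 :+ k) := b :+ k :+ con 2) refl b (k * 2) ⟩
  b + k * 2 + 2     ≤⟨ +-mono-≤ (legs-lower t b h k (S ∘ inj₁) (DeepDominated-⊕ˡ (legs k t) leg S dom))
                         (leg-lower (legs k t) S (dom (inj₂ ℓ₂) refl refl) (dom (inj₂ ℓ₃) refl refl)) ⟩
  count (legs (suc k) t) S ∎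
  where
  open ≤-Reasoning
  open +-*-Solver

-- The path starting at `w` may contain only one selected vertex, because `w` has two neighbours
-- beyond it. Then both of these are selected, and one is the centre; hence the centre is counted
-- together with this path.
F₂-lower : ∀ S → DeepDominated F₂ S → 4 ≤ count F₂ S
F₂-lower S dom = begin
  2 + 2 ≤⟨ +-mono-≤ first second ⟩
  (indicator (S ℓ₁) + count leg (S ∘ inj₂ ∘ inj₁)) + count leg (S ∘ inj₂ ∘ inj₂) ≡⟨ +-assoc (indicator (S ℓ₁)) _ _ ⟩
  count F₂ S ∎
  where
  open ≤-Reasoning
  path₁ : PendantPath (adj F₂) (inj₂ (inj₁ ℓ₁)) (inj₂ (inj₁ ℓ₂)) (inj₂ (inj₁ ℓ₃))
  path₁ = record
    { β-nbr = λ { ℓ₁ () ; (inj₂ (inj₁ ℓ₁)) _ → inj₁ refl ; (inj₂ (inj₁ ℓ₂)) ()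
                ; (inj₂ (inj₁ ℓ₃)) _ → inj₂ refl ; (inj₂ (inj₂ _)) () }
    ; γ-nbr = λ { ℓ₁ () ; (inj₂ (inj₁ ℓ₁)) () ; (inj₂ (inj₁ ℓ₂)) _ → refl
                ; (inj₂ (inj₁ ℓ₃)) () ; (inj₂ (inj₂ _)) () }
    }
  path₂ : PendantPath (adj F₂) (inj₂ (inj₂ ℓ₁)) (inj₂ (inj₂ ℓ₂)) (inj₂ (inj₂ ℓ₃))
  path₂ = record
    { β-nbr = λ { ℓ₁ () ; (inj₂ (inj₁ _)) () ; (inj₂ (inj₂ ℓ₁)) _ → inj₁ refl
                ; (inj₂ (inj₂ ℓ₂)) () ; (inj₂ (inj₂ ℓ₃)) _ → inj₂ refl }
    ; γ-nbr = λ { ℓ₁ () ; (inj₂ (inj₁ _)) () ; (inj₂ (inj₂ ℓ₁)) ()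
                ; (inj₂ (inj₂ ℓ₂)) _ → refl ; (inj₂ (inj₂ ℓ₃)) () }
    }
  Beyond₁ Beyond₂ : V F₂ → Set
  Beyond₁ = BeyondPath {S = S} path₁
  Beyond₂ = BeyondPath {S = S} path₂
  only : ∀ {u} → Beyond₂ u → u ≡ inj₂ (inj₁ ℓ₁)
  only {inj₂ (inj₁ ℓ₁)} _            = refl
  only {inj₂ (inj₂ ℓ₂)} (_ , _ , ≢ℓ₂) = contradiction refl ≢ℓ₂
  second : 2 ≤ count leg (S ∘ inj₂ ∘ inj₂)
  second with α∈S⊎γ∈S path₂ (dom (inj₂ (inj₂ ℓ₂)) refl refl)
  ... | inj₁ s = 2≤count-leg (S ∘ inj₂ ∘ inj₂) (β∈S path₂ (dom (inj₂ (inj₂ ℓ₃)) refl refl)) s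
  ... | inj₂ (_ , _ , u≢w , bu , bw) = contradiction (trans (only bu) (sym (only bw))) u≢w
  centre : ∀ {u w} → Beyond₁ u → Beyond₁ w → u ≢ w → S ℓ₁ ≡ true
  centre {ℓ₁}                               (s , _)       _             _   = s
  centre {inj₂ (inj₁ ℓ₂)}                   (_ , _ , ≢ℓ₂) _             _   = contradiction refl ≢ℓ₂
  centre {inj₂ (inj₂ ℓ₁)} {ℓ₁}              _             (s , _)       _   = s
  centre {inj₂ (inj₂ ℓ₁)} {inj₂ (inj₁ ℓ₂)}  _             (_ , _ , ≢ℓ₂) _   = contradiction refl ≢ℓ₂
  centre {inj₂ (inj₂ ℓ₁)} {inj₂ (inj₂ ℓ₁)}  _             _             u≢w = contradiction refl u≢w
  first : 2 ≤ indicator (S ℓ₁) + count leg (S ∘ inj₂ ∘ inj₁)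
  first with β∈S path₁ (dom (inj₂ (inj₁ ℓ₃)) refl refl) | α∈S⊎γ∈S path₁ (dom (inj₂ (inj₁ ℓ₂)) refl refl)
  ... | b | inj₁ s = ≤-trans (2≤count-leg (S ∘ inj₂ ∘ inj₁) b s) (m≤n+m _ (indicator (S ℓ₁)))
  ... | b | inj₂ (_ , _ , u≢w , bu , bw) = +-mono-≤
    (≤-reflexive (cong indicator (sym (centre bu bw u≢w))))
    (≤-trans (≤-reflexive (cong indicator (sym b))) (indicator≤count leg (S ∘ inj₂ ∘ inj₁) ℓ₂))

distinct⇒2≤count : ∀ t (S : V t → Bool) {u w} → u ≢ w → S u ≡ true → S w ≡ true → 2 ≤ count t S
distinct⇒2≤count •       S {tt}     {tt}     u≢w _ _  = contradiction refl u≢w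
distinct⇒2≤count (t ⊕ c) S {inj₁ u} {inj₁ w} u≢w s s′ =
  ≤-trans (distinct⇒2≤count t (S ∘ inj₁) (u≢w ∘ cong inj₁) s s′) (m≤m+n _ _)
distinct⇒2≤count (t ⊕ c) S {inj₂ u} {inj₂ w} u≢w s s′ =
  ≤-trans (distinct⇒2≤count c (S ∘ inj₂) (u≢w ∘ cong inj₂) s s′) (m≤n+m _ _)
distinct⇒2≤count (t ⊕ c) S {inj₁ u} {inj₂ w} _ s s′ =
  +-mono-≤ (≤-trans (≤-reflexive (cong indicator (sym s))) (indicator≤count t (S ∘ inj₁) u))
           (≤-trans (≤-reflexive (cong indicator (sym s′))) (indicator≤count c (S ∘ inj₂) w))
distinct⇒2≤count (t ⊕ c) S {inj₂ u} {inj₁ w} _ s s′ =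
  distinct⇒2≤count (t ⊕ c) S {inj₁ w} {inj₂ u} (λ ()) s′ s

dominator : ∀ t {S} {v} → Dominated (adj t) S v → ∃[ u ] v ≢ u × S u ≡ true
dominator t {v = v} (inj₁ (u , s , e))          = u , (λ { refl → true≢false e (adj-irrefl t v) }) , s
dominator t (inj₂ (u , _ , _ , s , _ , d , _)) = u , proj₁ d , s

-- No vertex dominates itself, so a dominator of a dominator is a second selected vertex.
2≤count-dominating : ∀ t {S} → (∀ v → Dominated (adj t) S v) → 2 ≤ count t S
2≤count-dominating t {S} dom =
  let u , _ , s = dominator t (dom (root t)) ; w , u≢w , s′ = dominator t (dom u)
  in distinct⇒2≤count t S u≢w s s′

-- The leg forces two vertices, the star around `hub` two more. If `leaf₁` is dominated by `hub`,
-- then `hub` needs a selected neighbour, having just one vertex at distance 2; otherwise `leaf₁`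
-- has two selected vertices at distance 2, both in the star.
T*-lower : ∀ S → (∀ v → Dominated (adj (• ⊕ cherry ⊕ leg)) S v) → 4 ≤ count (• ⊕ cherry ⊕ leg) S
T*-lower S dom = +-mono-≤ star (leg-lower (• ⊕ cherry) S (dom (inj₂ ℓ₂)) (dom (inj₂ ℓ₃)))
  where
  E = adj (• ⊕ cherry ⊕ leg)
  pattern hub   = inj₁ (inj₂ (inj₁ (inj₁ tt)))
  pattern leaf₁ = inj₁ (inj₂ (inj₁ (inj₂ tt)))
  pattern leaf₂ = inj₁ (inj₂ (inj₂ tt))
  pattern neck  = inj₁ (inj₁ tt)
  distinct : ∀ {u w} → u ≢ w → S (inj₁ u) ≡ true → S (inj₁ w) ≡ true → 2 ≤ count (• ⊕ cherry) (S ∘ inj₁)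
  distinct = distinct⇒2≤count (• ⊕ cherry) (S ∘ inj₁)
  hub-case : S hub ≡ true → Dominated E S hub → 2 ≤ count (• ⊕ cherry) (S ∘ inj₁)
  hub-case s (inj₁ (neck , s′ , _))  = distinct (λ ()) s s′
  hub-case s (inj₁ (leaf₁ , s′ , _)) = distinct (λ ()) s s′
  hub-case s (inj₁ (leaf₂ , s′ , _)) = distinct (λ ()) s s′
  hub-case s (inj₂ (u , w , u≢w , _ , _ , du , dw)) = contradiction (trans (only du) (sym (only dw))) u≢w
    where
    only : ∀ {u} → AtDistance2 E hub u → u ≡ inj₂ ℓ₁
    only {hub}    (≢hub , _)          = contradiction refl ≢hub
    only {inj₂ ℓ₁} _                   = refl
    only {inj₂ ℓ₂} (_ , _ , inj₁ (inj₁ tt) , _ , ())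
    only {inj₂ ℓ₃} (_ , _ , inj₁ (inj₁ tt) , _ , ())
  inside : ∀ {u} → AtDistance2 E leaf₁ u → ∃[ u′ ] u ≡ inj₁ u′
  inside {inj₁ u} _ = u , refl
  inside {inj₂ u} (_ , _ , hub , _ , ())
  star : 2 ≤ count (• ⊕ cherry) (S ∘ inj₁)
  star with dom leaf₁
  ... | inj₁ (hub , s , _) = hub-case s (dom hub)
  ... | inj₂ (u , w , u≢w , s , s′ , du , dw) with inside du | inside dw
  ...   | u′ , refl | w′ , refl = distinct (u≢w ∘ cong inj₁) s s′

size-legs : ∀ k t → size (legs k t) ≡ size t + k * 3
size-legs zero    t = sym (+-identityʳ _)
size-legs (suc k) t = trans (cong (_+ 3) (size-legs k t))
  (trans (+-assoc (size t) _ _) (cong (size t +_) (+-comm (k * 3) 3)))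

enum : ∀ t → V t ↔ Fin (size t)
enum •       = mk↔ₛ′ (λ _ → Fin.zero) (λ _ → tt) (λ { Fin.zero → refl ; (Fin.suc ()) }) (λ _ → refl)
enum (t ⊕ c) = ↔-trans (enum t ⊎-↔ enum c) (↔-sym Fin.+↔⊎)

-- Simple paths in rooted trees

data Path {A : Set} (E : A → A → Bool) : A → A → List A → Set where
  stop : ∀ {u} → Path E u u (u ∷ [])
  _∷_  : ∀ {u v w xs} → E u w ≡ true → Path E w v xs → Path E u v (u ∷ xs)

Path-map : {A B : Set} {E : A → A → Bool} {F : B → B → Bool} (f : A → B) →
  (∀ u v → E u v ≡ true → F (f u) (f v) ≡ true) → ∀ {u v xs} → Path E u v xs → Path F (f u) (f v) (map f xs)
Path-map f h stop    = stop
Path-map f h (e ∷ p) = h _ _ e ∷ Path-map f h p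

Path-++ : {A : Set} {E : A → A → Bool} {u v w z : A} {xs ys : List A} →
  Path E u v xs → E v w ≡ true → Path E w z ys → Path E u z (xs ++ ys)
Path-++ stop    e q = e ∷ q
Path-++ (d ∷ p) e q = d ∷ Path-++ p e q

inj₁-inj₂-disjoint : {A B : Set} {xs : List A} {ys : List B} {z : A ⊎ B} → z ∈ map inj₁ xs → z ∈ map inj₂ ys → ⊥
inj₁-inj₂-disjoint p q with ∈-map⁻ inj₁ p | ∈-map⁻ inj₂ q
... | _ , _ , refl | _ , _ , ()

simplePath : ∀ t u v → ∃[ xs ] Path (adj t) u v xs × Unique xs
simplePath • tt tt = tt ∷ [] , stop , [] ∷ []
simplePath (t ⊕ c) (inj₁ u) (inj₁ v) =
  let xs , p , uq = simplePath t u v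
  in map inj₁ xs , Path-map inj₁ (λ _ _ e → e) p , Unique.map⁺ inj₁-injective uq
simplePath (t ⊕ c) (inj₂ u) (inj₂ v) =
  let xs , p , uq = simplePath c u v
  in map inj₂ xs , Path-map inj₂ (λ _ _ e → e) p , Unique.map⁺ inj₂-injective uq
simplePath (t ⊕ c) (inj₁ u) (inj₂ v) =
  let xs , p , uq = simplePath t u (root t) ; ys , q , uq′ = simplePath c (root c) v
  in map inj₁ xs ++ map inj₂ ys ,
     Path-++ (Path-map inj₁ (λ _ _ e → e) p) (cong₂ _∧_ (isRoot-root t) (isRoot-root c))
             (Path-map inj₂ (λ _ _ e → e) q) ,
     Unique.++⁺ (Unique.map⁺ inj₁-injective uq) (Unique.map⁺ inj₂-injective uq′)
       (λ (a , b) → inj₁-inj₂-disjoint a b)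
simplePath (t ⊕ c) (inj₂ u) (inj₁ v) =
  let xs , p , uq = simplePath c u (root c) ; ys , q , uq′ = simplePath t (root t) v
  in map inj₂ xs ++ map inj₁ ys ,
     Path-++ (Path-map inj₂ (λ _ _ e → e) p) (cong₂ _∧_ (isRoot-root c) (isRoot-root t))
             (Path-map inj₁ (λ _ _ e → e) q) ,
     Unique.++⁺ (Unique.map⁺ inj₂-injective uq) (Unique.map⁺ inj₁-injective uq′)
       (λ (a , b) → inj₁-inj₂-disjoint b a)

Unique-lookup-injective : {A : Set} {xs : List A} → Unique xs → ∀ i j → lookup xs i ≡ lookup xs j → i ≡ j
Unique-lookup-injective (_ ∷ _)  Fin.zero    Fin.zero    _  = refl
Unique-lookup-injective (a ∷ _)  Fin.zero    (Fin.suc j) eq = contradiction eq (All.lookup a (∈-lookup j))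
Unique-lookup-injective (a ∷ _)  (Fin.suc i) Fin.zero    eq = contradiction (sym eq) (All.lookup a (∈-lookup i))
Unique-lookup-injective (_ ∷ uq) (Fin.suc i) (Fin.suc j) eq = cong Fin.suc (Unique-lookup-injective uq i j eq)

Path-consecutive : {A : Set} {E : A → A → Bool} {u v : A} {xs : List A} → Path E u v xs →
  ∀ i j → toℕ j ≡ suc (toℕ i) → E (lookup xs i) (lookup xs j) ≡ true
Path-consecutive stop              Fin.zero    Fin.zero               ()
Path-consecutive (e ∷ stop)        Fin.zero    (Fin.suc Fin.zero)     _  = e
Path-consecutive (e ∷ (_ ∷ _))     Fin.zero    (Fin.suc Fin.zero)     _  = e
Path-consecutive (e ∷ (_ ∷ _))     Fin.zero    (Fin.suc (Fin.suc _))  ()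
Path-consecutive (e ∷ p)           (Fin.suc i) (Fin.suc j)            eq = Path-consecutive p i j (suc-injective eq)

Path-last : {A : Set} {E : A → A → Bool} {u v x : A} {xs : List A} →
  Path E u v (x ∷ xs) → lookup (x ∷ xs) (fromℕ (length xs)) ≡ v
Path-last stop              = refl
Path-last (_ ∷ p@stop)      = Path-last p
Path-last (_ ∷ p@(_ ∷ _))   = Path-last p

-- As `u ≢ v`, the path has at least two vertices, so together with `y` there are the three that a
-- cycle requires.
closedPath⇒Cycle : ∀ {n} {G : Graph n} {u v y xs} → Path G u v xs → Unique xs → u ≢ v → All (y ≢_) xs →
  G y u ≡ true → G v y ≡ true → Cycle G
closedPath⇒Cycle stop _ u≢v _ _ _ = contradiction refl u≢v
closedPath⇒Cycle {G = G} {y = y} {xs = u ∷ _ ∷ zs} p@(_ ∷ _) uq _ fresh e e′ = record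
  { k       = length zs
  ; c       = lookup (y ∷ u ∷ _ ∷ zs)
  ; inj     = Unique-lookup-injective (fresh ∷ uq)
  ; consec  = Path-consecutive (e ∷ p)
  ; closing = subst (λ z → G z y ≡ true) (sym (Path-last (e ∷ p))) e′
  }

-- Growing a rooted tree leaf by leaf inside a graph.

same : ∀ t → V t → V t → Bool
same •       _        _        = true
same (t ⊕ c) (inj₁ u) (inj₁ v) = same t u v
same (t ⊕ c) (inj₂ u) (inj₂ v) = same c u v
same (t ⊕ c) _        _        = false

same⇒≡ : ∀ t u v → same t u v ≡ true → u ≡ v
same⇒≡ •       _        _        _ = refl
same⇒≡ (t ⊕ c) (inj₁ u) (inj₁ v) s = cong inj₁ (same⇒≡ t u v s)
same⇒≡ (t ⊕ c) (inj₂ u) (inj₂ v) s = cong inj₂ (same⇒≡ c u v s)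

same-refl : ∀ t v → same t v v ≡ true
same-refl •       _        = refl
same-refl (t ⊕ c) (inj₁ v) = same-refl t v
same-refl (t ⊕ c) (inj₂ v) = same-refl c v

-- The leaf becomes the first child of the chosen vertex, since the recursion ends at the `•`
-- underlying that vertex.
addLeaf : ∀ t → V t → RTree
addLeaf •       _        = • ⊕ •
addLeaf (t ⊕ c) (inj₁ v) = addLeaf t v ⊕ c
addLeaf (t ⊕ c) (inj₂ v) = t ⊕ addLeaf c v

size-addLeaf : ∀ t v → size (addLeaf t v) ≡ suc (size t)
size-addLeaf •       _        = refl
size-addLeaf (t ⊕ c) (inj₁ v) = cong (_+ size c) (size-addLeaf t v)
size-addLeaf (t ⊕ c) (inj₂ v) = trans (cong (size t +_) (size-addLeaf c v)) (+-suc (size t) (size c))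

-- The new leaf is sent to nothing.
peel : ∀ t v → V (addLeaf t v) → Maybe (V t)
peel •       _        (inj₁ _) = just tt
peel •       _        (inj₂ _) = nothing
peel (t ⊕ c) (inj₁ v) (inj₁ x) = Maybe.map inj₁ (peel t v x)
peel (t ⊕ c) (inj₁ v) (inj₂ x) = just (inj₂ x)
peel (t ⊕ c) (inj₂ v) (inj₁ x) = just (inj₁ x)
peel (t ⊕ c) (inj₂ v) (inj₂ x) = Maybe.map inj₂ (peel c v x)

map-injective : {A B : Set} {f : A → B} → Injective _≡_ _≡_ f → Injective _≡_ _≡_ (Maybe.map f)
map-injective f-inj {just _}  {just _}  eq = cong just (f-inj (just-inj eq))
  where
  just-inj : {A : Set} {x y : A} → just x ≡ just y → x ≡ y
  just-inj refl = refl
map-injective f-inj {nothing} {nothing} _  = refl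

peel-injective : ∀ t v → Injective _≡_ _≡_ (peel t v)
peel-injective •       _        {inj₁ _} {inj₁ _} _  = refl
peel-injective •       _        {inj₂ _} {inj₂ _} _  = refl
peel-injective (t ⊕ c) (inj₁ v) {inj₁ x} {inj₁ y} eq = cong inj₁ (peel-injective t v (map-injective inj₁-injective eq))
peel-injective (t ⊕ c) (inj₁ v) {inj₁ x} {inj₂ y} eq with peel t v x
peel-injective (t ⊕ c) (inj₁ v) {inj₁ x} {inj₂ y} () | just _
peel-injective (t ⊕ c) (inj₁ v) {inj₁ x} {inj₂ y} () | nothing
peel-injective (t ⊕ c) (inj₁ v) {inj₂ x} {inj₁ y} eq with peel t v y
peel-injective (t ⊕ c) (inj₁ v) {inj₂ x} {inj₁ y} () | just _
peel-injective (t ⊕ c) (inj₁ v) {inj₂ x} {inj₁ y} () | nothing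
peel-injective (t ⊕ c) (inj₁ v) {inj₂ x} {inj₂ y} refl = refl
peel-injective (t ⊕ c) (inj₂ v) {inj₂ x} {inj₂ y} eq = cong inj₂ (peel-injective c v (map-injective inj₂-injective eq))
peel-injective (t ⊕ c) (inj₂ v) {inj₂ x} {inj₁ y} eq with peel c v x
peel-injective (t ⊕ c) (inj₂ v) {inj₂ x} {inj₁ y} () | just _
peel-injective (t ⊕ c) (inj₂ v) {inj₂ x} {inj₁ y} () | nothing
peel-injective (t ⊕ c) (inj₂ v) {inj₁ x} {inj₂ y} eq with peel c v y
peel-injective (t ⊕ c) (inj₂ v) {inj₁ x} {inj₂ y} () | just _
peel-injective (t ⊕ c) (inj₂ v) {inj₁ x} {inj₂ y} () | nothing
peel-injective (t ⊕ c) (inj₂ v) {inj₁ x} {inj₁ y} refl = refl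

pendant : ∀ t → V t → Maybe (V t) → Maybe (V t) → Bool
pendant t v (just a) (just b) = adj t a b
pendant t v (just a) nothing  = same t a v
pendant t v nothing  (just b) = same t b v
pendant t v nothing  nothing  = false

isRoot-addLeaf : ∀ t v x → isRoot (addLeaf t v) x ≡ maybe (isRoot t) false (peel t v x)
isRoot-addLeaf •       _        (inj₁ _) = refl
isRoot-addLeaf •       _        (inj₂ _) = refl
isRoot-addLeaf (t ⊕ c) (inj₁ v) (inj₁ x) with peel t v x | isRoot-addLeaf t v x
... | just _  | r = r
... | nothing | r = r
isRoot-addLeaf (t ⊕ c) (inj₁ v) (inj₂ x) = refl
isRoot-addLeaf (t ⊕ c) (inj₂ v) (inj₁ x) = refl
isRoot-addLeaf (t ⊕ c) (inj₂ v) (inj₂ x) with peel c v x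
... | just _  = refl
... | nothing = refl

-- Everything is expressed through `peel`, so an embedding of `t` extends by merely choosing an
-- image for `nothing`.
adj-addLeaf : ∀ t v x y → adj (addLeaf t v) x y ≡ pendant t v (peel t v x) (peel t v y)
adj-addLeaf •       _        (inj₁ _) (inj₁ _) = refl
adj-addLeaf •       _        (inj₁ _) (inj₂ _) = refl
adj-addLeaf •       _        (inj₂ _) (inj₁ _) = refl
adj-addLeaf •       _        (inj₂ _) (inj₂ _) = refl
adj-addLeaf (t ⊕ c) (inj₁ v) (inj₁ x) (inj₁ y) with peel t v x | peel t v y | adj-addLeaf t v x y
... | just _  | just _  | e = e
... | just _  | nothing | e = e
... | nothing | just _  | e = e
... | nothing | nothing | e = e
adj-addLeaf (t ⊕ c) (inj₁ v) (inj₁ x) (inj₂ y) with peel t v x | isRoot-addLeaf t v x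
... | just _  | r = cong (_∧ isRoot c y) r
... | nothing | r = cong (_∧ isRoot c y) r
adj-addLeaf (t ⊕ c) (inj₁ v) (inj₂ x) (inj₁ y) with peel t v y | isRoot-addLeaf t v y
... | just _  | r = cong (isRoot c x ∧_) r
... | nothing | r = trans (cong (isRoot c x ∧_) r) (∧-zeroʳ _)
adj-addLeaf (t ⊕ c) (inj₁ v) (inj₂ x) (inj₂ y) = refl
adj-addLeaf (t ⊕ c) (inj₂ v) (inj₂ x) (inj₂ y) with peel c v x | peel c v y | adj-addLeaf c v x y
... | just _  | just _  | e = e
... | just _  | nothing | e = e
... | nothing | just _  | e = e
... | nothing | nothing | e = e
adj-addLeaf (t ⊕ c) (inj₂ v) (inj₂ x) (inj₁ y) with peel c v x | isRoot-addLeaf c v x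
... | just _  | r = cong (_∧ isRoot t y) r
... | nothing | r = cong (_∧ isRoot t y) r
adj-addLeaf (t ⊕ c) (inj₂ v) (inj₁ x) (inj₂ y) with peel c v y | isRoot-addLeaf c v y
... | just _  | r = cong (isRoot t x ∧_) r
... | nothing | r = trans (cong (isRoot t x ∧_) r) (∧-zeroʳ _)
adj-addLeaf (t ⊕ c) (inj₂ v) (inj₁ x) (inj₁ y) = refl

anyVertex? : ∀ t {P : V t → Set} → (∀ v → Dec (P v)) → Dec (∃ P)
anyVertex? •       P? = map′ (tt ,_) proj₂ (P? tt)
anyVertex? (t ⊕ c) P? = map′
  [ (λ (v , p) → inj₁ v , p) , (λ (v , p) → inj₂ v , p) ]
  (λ { (inj₁ v , p) → inj₁ (v , p) ; (inj₂ v , p) → inj₂ (v , p) })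
  (anyVertex? t (P? ∘ inj₁) ⊎-dec anyVertex? c (P? ∘ inj₂))

injective⇒size≤ : ∀ t {n} {f : V t → Fin n} → Injective _≡_ _≡_ f → size t ≤ n
injective⇒size≤ t {f = f} f-inj = Fin.injective⇒≤ {f = f ∘ from} λ eq →
  trans (sym (strictlyInverseˡ _)) (trans (cong to (f-inj eq)) (strictlyInverseˡ _))
  where open Inverse (enum t)

bijective⇒↔ : {A B : Set} {f : A → B} → Injective _≡_ _≡_ f → (∀ y → ∃[ x ] f x ≡ y) → A ↔ B
bijective⇒↔ {f = f} f-inj f-surj = mk↔ₛ′ f (proj₁ ∘ f-surj) (proj₂ ∘ f-surj) (λ x → f-inj (proj₂ (f-surj (f x))))

module _ {n} {G : Graph n} (G-sym : Symmetric G) (G-irrefl : Irreflexive G)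
  (connected : Connected G) (acyclic : Acyclic G) where

  private
    record Embedding (t : RTree) : Set where
      field
        f         : V t → Fin n
        injective : Injective _≡_ _≡_ f
        induced   : ∀ u v → adj t u v ≡ G (f u) (f v)

    module _ {t : RTree} (emb : Embedding t) where
      open Embedding emb

      Hit : Fin n → Set
      Hit y = ∃[ v ] f v ≡ y

      hit? : ∀ y → Dec (Hit y)
      hit? y = anyVertex? t (λ v → f v Fin.≟ y)

      -- Connectivity enters here: a walk from the image to a missed vertex must leave the image
      -- along some edge.
      exit : ∀ {x y} → Walk G x y → Hit x → ¬ Hit y → ∃[ v ] ∃[ z ] G (f v) z ≡ true × ¬ Hit z
      exit here hx ¬hy = contradiction hx ¬hy
      exit (step {w = w} e walk) (v , refl) ¬hy with hit? w
      ... | yes hw = exit walk hw ¬hy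
      ... | no ¬hw = v , w , e , ¬hw

      -- Acyclicity enters here: the image of the tree path between two neighbours of `y` would
      -- close to a cycle through `y`. Hence the enlarged embedding stays induced.
      one-neighbour : ∀ {u v y} → ¬ Hit y → u ≢ v → G (f u) y ≡ true → G (f v) y ≡ true → ⊥
      one-neighbour {u} {v} {y} ¬hit u≢v e e′ =
        let xs , p , uq = simplePath t u v
        in acyclic (closedPath⇒Cycle
             (Path-map f (λ a b e → trans (sym (induced a b)) e) p)
             (Unique.map⁺ injective uq) (u≢v ∘ injective)
             (All.map⁺ (All.universal (λ x eq → ¬hit (x , sym eq)) xs))
             (trans (G-sym y (f u)) e) e′)

      extend : ∀ {v y} → G (f v) y ≡ true → ¬ Hit y → Embedding (addLeaf t v)
      extend {v} {y} e ¬hit = record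
        { f = g ∘ peel t v ; injective = peel-injective t v ∘ g-injective ; induced = g-induced }
        where
        g : Maybe (V t) → Fin n
        g = maybe f y
        g-injective : Injective _≡_ _≡_ g
        g-injective {just _}  {just _}  eq = cong just (injective eq)
        g-injective {just a}  {nothing} eq = contradiction (a , eq) ¬hit
        g-injective {nothing} {just b}  eq = contradiction (b , sym eq) ¬hit
        g-injective {nothing} {nothing} _  = refl
        edge-to-y : ∀ a → same t a v ≡ G (f a) y
        edge-to-y a with true⊎false (same t a v) | true⊎false (G (f a) y)
        ... | inj₁ s | _       = trans s (sym (trans (cong (λ a → G (f a) y) (same⇒≡ t a v s)) e))
        ... | inj₂ s | inj₂ e′ = trans s (sym e′)
        ... | inj₂ s | inj₁ e′ = ⊥-elim (one-neighbour ¬hit (λ { refl → true≢false (same-refl t a) s }) e′ e)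
        pendant-induced : ∀ a b → pendant t v a b ≡ G (g a) (g b)
        pendant-induced (just a) (just b) = induced a b
        pendant-induced (just a) nothing  = edge-to-y a
        pendant-induced nothing  (just b) = trans (edge-to-y b) (G-sym (f b) y)
        pendant-induced nothing  nothing  = sym (G-irrefl y)
        g-induced : ∀ a b → adj (addLeaf t v) a b ≡ G (g (peel t v a)) (g (peel t v b))
        g-induced a b = trans (adj-addLeaf t v a b) (pendant-induced (peel t v a) (peel t v b))

    -- `m` bounds the number of vertices still missed. At zero one more leaf would embed more than
    -- `n` vertices.
    grow : ∀ m t → n ≤ size t + m → Embedding t → ∃[ t′ ] Iso (adj t′) G
    grow m t n≤ emb with Fin.all? (hit? emb)
    ... | yes surj = t , bijective⇒↔ (Embedding.injective emb) surj , Embedding.induced emb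
    ... | no ¬surj
      with y , ¬hy ← Fin.¬∀⟶∃¬ n (Hit emb) (hit? emb) ¬surj
      with v , z , e , ¬hz ← exit emb (connected (Embedding.f emb (root t)) y) (root t , refl) ¬hy
      with bigger ← extend emb e ¬hz
      with m
    ... | zero = contradiction
      (≤-trans (subst (_≤ n) (size-addLeaf t v) (injective⇒size≤ (addLeaf t v) (Embedding.injective bigger)))
               (≤-trans n≤ (≤-reflexive (+-identityʳ _)))) 1+n≰n
    ... | suc m′ = grow m′ (addLeaf t v)
      (≤-trans n≤ (≤-reflexive (trans (+-suc (size t) m′) (cong (_+ m′) (sym (size-addLeaf t v)))))) bigger

  asRTree : Fin n → ∃[ t ] Iso (adj t) G
  asRTree r = grow n • (n≤1+n n) record
    { f = λ _ → r ; injective = λ _ → refl ; induced = λ _ _ → sym (G-irrefl r) }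

-- Cardinalities

sum-+ : ∀ m {n} (f : Fin (m + n) → ℕ) → sum f ≡ sum (f ∘ (_↑ˡ n)) + sum (f ∘ (m ↑ʳ_))
sum-+ zero    f = refl
sum-+ (suc m) f = trans (cong (f Fin.zero +_) (sum-+ m (f ∘ Fin.suc))) (sym (+-assoc (f Fin.zero) _ _))

count≡sum : ∀ t S → count t S ≡ sum (indicator ∘ S ∘ Inverse.from (enum t))
count≡sum •       S = sym (+-identityʳ _)
count≡sum (t ⊕ c) S = trans
  (cong₂ _+_ (trans (count≡sum t (S ∘ inj₁)) (sum-cong-≗ λ i → cong at (sym (Fin.splitAt-↑ˡ (size t) i (size c)))))
             (trans (count≡sum c (S ∘ inj₂)) (sum-cong-≗ λ i → cong at (sym (Fin.splitAt-↑ʳ (size t) (size c) i)))))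
  (sym (sum-+ (size t) (indicator ∘ S ∘ Inverse.from (enum (t ⊕ c)))))
  where
  at : Fin (size t) ⊎ Fin (size c) → ℕ
  at = indicator ∘ S ∘ Sum.map (Inverse.from (enum t)) (Inverse.from (enum c))

∣∣≡sum : ∀ {n} (S : Subset n) → ∣ S ∣ ≡ sum (indicator ∘ Vec.lookup S)
∣∣≡sum []          = refl
∣∣≡sum (true ∷ S)  = cong suc (∣∣≡sum S)
∣∣≡sum (false ∷ S) = ∣∣≡sum S

module _ {t : RTree} {n : ℕ} (f : V t ↔ Fin n) where

  size≡ : size t ≡ n
  size≡ = ↔⇒≡ (↔-trans (↔-sym (enum t)) f)

  count≡∣∣ : ∀ S → count t (Vec.lookup S ∘ Inverse.to f) ≡ ∣ S ∣
  count≡∣∣ S = begin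
    count t (Vec.lookup S ∘ Inverse.to f)  ≡⟨ count≡sum t _ ⟩
    sum (indicator ∘ Vec.lookup S ∘ Inverse.to f ∘ Inverse.from (enum t))
      ≡⟨ sum-permute (indicator ∘ Vec.lookup S) (↔-trans (↔-sym (enum t)) f) ⟨
    sum (indicator ∘ Vec.lookup S)         ≡⟨ ∣∣≡sum S ⟨
    ∣ S ∣                                  ∎
    where open ≡-Reasoning

IsDTD⇒Dominated : ∀ {n} {G : Graph n} {S} → IsDTD G S → ∀ v → Dominated G (Vec.lookup S) v
IsDTD⇒Dominated dtd v with dtd v
... | inj₁ (u , s , e) = inj₁ (u , []=⇒lookup s , e)
... | inj₂ (u , w , u≢w , s , s′ , d) = inj₂ (u , w , u≢w , []=⇒lookup s , []=⇒lookup s′ , d)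

Dominated⇒IsDTD : ∀ {n} {G : Graph n} {S} → (∀ v → Dominated G (Vec.lookup S) v) → IsDTD G S
Dominated⇒IsDTD {S = S} dom v with dom v
... | inj₁ (u , s , e) = inj₁ (u , lookup⇒[]= u S s , e)
... | inj₂ (u , w , u≢w , s , s′ , d) = inj₂ (u , w , u≢w , lookup⇒[]= u S s , lookup⇒[]= w S s′ , d)

-- Identification with the numbered trees

allVertices? : ∀ t {P : V t → Set} → (∀ v → Dec (P v)) → Dec (∀ v → P v)
allVertices? •       P? = map′ (λ p _ → p) (λ p → p tt) (P? tt)
allVertices? (t ⊕ c) P? = map′ (λ { (p , q) (inj₁ v) → p v ; (p , q) (inj₂ v) → q v }) (λ p → p ∘ inj₁ , p ∘ inj₂)
  (allVertices? t (P? ∘ inj₁) ×-dec allVertices? c (P? ∘ inj₂))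

-- A missed `y` could serve as the image of the extra leaf of `t ⊕ •`, giving an injection from more
-- than `n` vertices.
injective⇒Iso : ∀ {t n} (G : Graph n) (f : V t → Fin n) → Injective _≡_ _≡_ f → n ≤ size t →
  (∀ u v → adj t u v ≡ G (f u) (f v)) → Iso (adj t) G
injective⇒Iso {t} {n} G f f-inj n≤ induced = bijective⇒↔ f-inj surjective , induced
  where
  surjective : ∀ y → ∃[ v ] f v ≡ y
  surjective y with anyVertex? t (λ v → f v Fin.≟ y)
  ... | yes hit = hit
  ... | no ¬hit = contradiction
    (≤-trans (≤-reflexive (+-comm 1 _)) (≤-trans (injective⇒size≤ (t ⊕ •) g-inj) n≤)) 1+n≰n
    where
    g : V (t ⊕ •) → Fin n
    g = Sum.[ f , (λ _ → y) ]
    g-inj : Injective _≡_ _≡_ g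
    g-inj {inj₁ _} {inj₁ _} eq = cong inj₁ (f-inj eq)
    g-inj {inj₁ u} {inj₂ _} eq = contradiction (u , eq) ¬hit
    g-inj {inj₂ _} {inj₁ v} eq = contradiction (v , sym eq) ¬hit
    g-inj {inj₂ _} {inj₂ _} _  = refl

edge? : ℕ → ℕ → ℕ × ℕ → Bool
edge? a b (x , y) = ((a ≡ᵇ x) ∧ (b ≡ᵇ y)) ∨ ((a ≡ᵇ y) ∧ (b ≡ᵇ x))

adjacent : List (ℕ × ℕ) → ℕ → ℕ → Bool
adjacent es a b = any (edge? a b) es

any-++ : {A : Set} (p : A → Bool) (xs ys : List A) → any p (xs ++ ys) ≡ any p xs ∨ any p ys
any-++ p []       ys = refl
any-++ p (x ∷ xs) ys = trans (cong (p x ∨_) (any-++ p xs ys)) (sym (∨-assoc (p x) _ _))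

<⇒≡ᵇ-false : ∀ {a b} → a < b → (a ≡ᵇ b) ≡ false
<⇒≡ᵇ-false {zero}  {suc b} _         = refl
<⇒≡ᵇ-false {suc a} {suc b} (s≤s a<b) = <⇒≡ᵇ-false a<b

>⇒≡ᵇ-false : ∀ {a b} → b < a → (a ≡ᵇ b) ≡ false
>⇒≡ᵇ-false {suc a} {zero}  _         = refl
>⇒≡ᵇ-false {suc a} {suc b} (s≤s a<b) = >⇒≡ᵇ-false a<b

≡ᵇ-refl : ∀ a → (a ≡ᵇ a) ≡ true
≡ᵇ-refl zero    = refl
≡ᵇ-refl (suc a) = ≡ᵇ-refl a

Below : ℕ → ℕ × ℕ → Set
Below s (x , y) = x < s × y < s

adjacent-≥ : ∀ {s es} → All (Below s) es → ∀ {a} b → s ≤ a → adjacent es a b ≡ false × adjacent es b a ≡ false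
adjacent-≥ []                    b s≤a = refl , refl
adjacent-≥ ((x< , y<) ∷ below) {a} b s≤a
  rewrite >⇒≡ᵇ-false (≤-trans x< s≤a) | >⇒≡ᵇ-false (≤-trans y< s≤a)
        | proj₁ (adjacent-≥ below b s≤a) | proj₂ (adjacent-≥ below b s≤a) =
  refl , cong (_∨ false) (cong₂ _∨_ (∧-zeroʳ (b ≡ᵇ _)) (∧-zeroʳ (b ≡ᵇ _)))

legEdges : ℕ → List (ℕ × ℕ)
legEdges s = (0 , s) ∷ (s , 1 + s) ∷ (1 + s , 2 + s) ∷ []

-- Natural numbers instead of `Fin` let the edge lists for successive `k` speak of the same
-- vertices; `outside` keeps the old edges away from the numbers of a new leg.
record Numbering (t : RTree) (N : ℕ → ℕ → Bool) : Set where
  field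
    num       : V t → ℕ
    num<      : ∀ v → num v < size t
    injective : Injective _≡_ _≡_ num
    num-root  : num (root t) ≡ 0
    induced   : ∀ u v → adj t u v ≡ N (num u) (num v)
    outside   : ∀ {a} b → size t ≤ a → N a b ≡ false × N b a ≡ false

-- Only the adjacencies have to agree, not the lists: `FkEdges` does not keep the edges of its last
-- leg together.
addLeg : ∀ {t N} N′ → (∀ a b → N′ a b ≡ N a b ∨ adjacent (legEdges (size t)) a b) →
  Numbering t N → Numbering (t ⊕ leg) N′
addLeg {t} {N} N′ N′≡ ν = record
  { num       = num′
  ; num<      = num′<
  ; injective = injective′
  ; num-root  = num-root
  ; induced   = λ u v → trans (induced′ u v) (sym (N′≡ (num′ u) (num′ v)))
  ; outside   = outside′
  }
  where
  open Numbering ν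
  s = size t
  num′ : V (t ⊕ leg) → ℕ
  num′ (inj₁ v) = num v
  num′ (inj₂ ℓ₁) = s
  num′ (inj₂ ℓ₂) = 1 + s
  num′ (inj₂ ℓ₃) = 2 + s
  num′< : ∀ v → num′ v < s + 3
  num′< (inj₁ v) = ≤-trans (num< v) (m≤m+n _ _)
  num′< (inj₂ ℓ₁) = ≤-trans (s≤s (m≤n+m s 2)) (≤-reflexive (+-comm 3 s))
  num′< (inj₂ ℓ₂) = ≤-trans (s≤s (s≤s (m≤n+m s 1))) (≤-reflexive (+-comm 3 s))
  num′< (inj₂ ℓ₃) = ≤-reflexive (+-comm 3 s)
  old≢new : ∀ u k → num u ≢ k + s
  old≢new u k eq = <⇒≢ (≤-trans (num< u) (m≤n+m s k)) eq
  injective′ : Injective _≡_ _≡_ num′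
  injective′ {inj₁ u} {inj₁ v} eq = cong inj₁ (injective eq)
  injective′ {inj₁ u} {inj₂ ℓ₁} eq = contradiction eq (old≢new u 0)
  injective′ {inj₁ u} {inj₂ ℓ₂} eq = contradiction eq (old≢new u 1)
  injective′ {inj₁ u} {inj₂ ℓ₃} eq = contradiction eq (old≢new u 2)
  injective′ {inj₂ ℓ₁} {inj₁ v} eq = contradiction (sym eq) (old≢new v 0)
  injective′ {inj₂ ℓ₂} {inj₁ v} eq = contradiction (sym eq) (old≢new v 1)
  injective′ {inj₂ ℓ₃} {inj₁ v} eq = contradiction (sym eq) (old≢new v 2)
  injective′ {inj₂ ℓ₁} {inj₂ ℓ₁} eq = refl
  injective′ {inj₂ ℓ₁} {inj₂ ℓ₂} eq = contradiction eq (m≢1+n+m s {0})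
  injective′ {inj₂ ℓ₁} {inj₂ ℓ₃} eq = contradiction eq (m≢1+n+m s {1})
  injective′ {inj₂ ℓ₂} {inj₂ ℓ₁} eq = contradiction (sym eq) (m≢1+n+m s {0})
  injective′ {inj₂ ℓ₂} {inj₂ ℓ₂} eq = refl
  injective′ {inj₂ ℓ₂} {inj₂ ℓ₃} eq = contradiction (suc-injective eq) (m≢1+n+m s {0})
  injective′ {inj₂ ℓ₃} {inj₂ ℓ₁} eq = contradiction (sym eq) (m≢1+n+m s {1})
  injective′ {inj₂ ℓ₃} {inj₂ ℓ₂} eq = contradiction (sym (suc-injective eq)) (m≢1+n+m s {0})
  injective′ {inj₂ ℓ₃} {inj₂ ℓ₃} eq = refl

  num-zero : ∀ u → (num u ≡ᵇ 0) ≡ isRoot t u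
  num-zero u with true⊎false (isRoot t u)
  ... | inj₁ r rewrite r | isRoot⇒≡ t u r | num-root = refl
  ... | inj₂ r rewrite r with num u in eq
  ...   | suc _ = refl
  ...   | zero with refl ← injective (trans eq (sym num-root)) = ⊥-elim (true≢false (isRoot-root t) r)

  -- Which of the endpoints 0, s, 1 + s, 2 + s of the new edges a vertex is.
  Tests : Set
  Tests = Bool × Bool × Bool × Bool
  tests : ℕ → Tests
  tests a = (a ≡ᵇ 0) , (a ≡ᵇ s) , (a ≡ᵇ 1 + s) , (a ≡ᵇ 2 + s)
  newEdge : Tests → Tests → Bool
  newEdge (a₀ , a₁ , a₂ , a₃) (b₀ , b₁ , b₂ , b₃) =
    ((a₀ ∧ b₁) ∨ (a₁ ∧ b₀)) ∨ ((a₁ ∧ b₂) ∨ (a₂ ∧ b₁)) ∨ ((a₂ ∧ b₃) ∨ (a₃ ∧ b₂)) ∨ false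
  code : V (t ⊕ leg) → Tests
  code (inj₁ v) = isRoot t v , false , false , false
  code (inj₂ ℓ₁) = false , true , false , false
  code (inj₂ ℓ₂) = false , false , true , false
  code (inj₂ ℓ₃) = false , false , false , true
  0<s : 0 < s
  0<s = ≤-trans (s≤s z≤n) (num< (root t))
  tests≡code : ∀ v → tests (num′ v) ≡ code v
  tests≡code (inj₁ v) = cong₂ _,_ (num-zero v) (cong₂ _,_ (<⇒≡ᵇ-false (num< v))
    (cong₂ _,_ (<⇒≡ᵇ-false (≤-trans (num< v) (n≤1+n s))) (<⇒≡ᵇ-false (≤-trans (num< v) (m≤n+m s 2)))))
  tests≡code (inj₂ ℓ₁) = cong₂ _,_ (>⇒≡ᵇ-false 0<s) (cong₂ _,_ (≡ᵇ-refl s)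
    (cong₂ _,_ (<⇒≡ᵇ-false (n<1+n s)) (<⇒≡ᵇ-false (m≤n+m (1 + s) 1))))
  tests≡code (inj₂ ℓ₂) = cong₂ _,_ refl (cong₂ _,_ (>⇒≡ᵇ-false (n<1+n s))
    (cong₂ _,_ (≡ᵇ-refl s) (<⇒≡ᵇ-false (n<1+n s))))
  tests≡code (inj₂ ℓ₃) = cong₂ _,_ refl (cong₂ _,_ (>⇒≡ᵇ-false (m≤n+m (1 + s) 1))
    (cong₂ _,_ (>⇒≡ᵇ-false (n<1+n s)) (≡ᵇ-refl s)))

  num′≥ : ∀ w → s ≤ num′ (inj₂ w)
  num′≥ ℓ₁ = ≤-refl
  num′≥ ℓ₂ = n≤1+n s
  num′≥ ℓ₃ = m≤n+m s 2

  from-root : ∀ r w → r ∧ isRoot leg w ≡ newEdge (r , false , false , false) (code (inj₂ w))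
  from-root true  ℓ₁ = refl
  from-root false ℓ₁ = refl
  from-root true  ℓ₂ = refl
  from-root false ℓ₂ = refl
  from-root true  ℓ₃ = refl
  from-root false ℓ₃ = refl

  to-root : ∀ r w → isRoot leg w ∧ r ≡ newEdge (code (inj₂ w)) (r , false , false , false)
  to-root true  ℓ₁ = refl
  to-root false ℓ₁ = refl
  to-root _     ℓ₂ = refl
  to-root _     ℓ₃ = refl

  within-leg : ∀ w z → adj leg w z ≡ newEdge (code (inj₂ w)) (code (inj₂ z))
  within-leg ℓ₁ ℓ₁ = refl
  within-leg ℓ₁ ℓ₂ = refl
  within-leg ℓ₁ ℓ₃ = refl
  within-leg ℓ₂ ℓ₁ = refl
  within-leg ℓ₂ ℓ₂ = refl
  within-leg ℓ₂ ℓ₃ = refl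
  within-leg ℓ₃ ℓ₁ = refl
  within-leg ℓ₃ ℓ₂ = refl
  within-leg ℓ₃ ℓ₃ = refl

  coded : ∀ u v → adj (t ⊕ leg) u v ≡ N (num′ u) (num′ v) ∨ newEdge (code u) (code v)
  coded (inj₁ u) (inj₁ v) with isRoot t u
  ... | true  = trans (induced u v) (sym (∨-identityʳ _))
  ... | false = trans (induced u v) (sym (∨-identityʳ _))
  coded (inj₁ u) (inj₂ w) = trans (from-root (isRoot t u) w)
    (cong (_∨ newEdge (code (inj₁ u)) (code (inj₂ w))) (sym (proj₂ (outside (num u) (num′≥ w)))))
  coded (inj₂ w) (inj₁ v) = trans (to-root (isRoot t v) w)
    (cong (_∨ newEdge (code (inj₂ w)) (code (inj₁ v))) (sym (proj₁ (outside (num v) (num′≥ w)))))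
  coded (inj₂ w) (inj₂ z) = trans (within-leg w z)
    (cong (_∨ newEdge (code (inj₂ w)) (code (inj₂ z))) (sym (proj₁ (outside (num′ (inj₂ z)) (num′≥ w)))))

  induced′ : ∀ u v → adj (t ⊕ leg) u v ≡ N (num′ u) (num′ v) ∨ adjacent (legEdges s) (num′ u) (num′ v)
  -- `adjacent (legEdges s)` unfolds to `newEdge` of the tests, so replacing tests by codes is
  -- enough.
  induced′ u v = trans (coded u v) (cong (N (num′ u) (num′ v) ∨_) (sym (cong₂ newEdge (tests≡code u) (tests≡code v))))

  outside′ : ∀ {a} b → s + 3 ≤ a → N′ a b ≡ false × N′ b a ≡ false
  outside′ {a} b h =
    let o , o′ = outside b (≤-trans (m≤m+n s 3) h)
        l , l′ = adjacent-≥ {es = legEdges s} ((≤-trans (s≤s z≤n) 3≤ , s<) ∷ (s< , 1+s<) ∷ (1+s< , 3+s≤) ∷ []) b h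
    in trans (N′≡ a b) (cong₂ _∨_ o l) , trans (N′≡ b a) (cong₂ _∨_ o′ l′)
    where
    3+s≤ : 3 + s ≤ s + 3
    3+s≤ = ≤-reflexive (+-comm 3 s)
    3≤ : 3 ≤ s + 3
    3≤ = m≤n+m 3 s
    s< : s < s + 3
    s< = ≤-trans (s≤s (m≤n+m s 2)) 3+s≤
    1+s< : 1 + s < s + 3
    1+s< = ≤-trans (s≤s (s≤s (n≤1+n s))) 3+s≤

Numbering⇒Iso : ∀ {t n} es → size t ≡ n → Numbering t (adjacent es) → Iso (adj t) (fromEdges n es)
Numbering⇒Iso {t} {n} es refl ν = injective⇒Iso (fromEdges n es) (λ v → fromℕ< (num< v))
  (λ eq → injective (trans (sym (Fin.toℕ-fromℕ< _)) (trans (cong toℕ eq) (Fin.toℕ-fromℕ< _)))) ≤-refl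
  (λ u v → trans (induced u v) (sym (cong₂ (adjacent es) (Fin.toℕ-fromℕ< (num< u)) (Fin.toℕ-fromℕ< (num< v)))))
  where open Numbering ν

module _ (t : RTree) {n : ℕ} (π : Vec (Fin n) (size t)) where

  relabel : V t → Fin n
  relabel v = Vec.lookup π (Inverse.to (enum t) v)

  π-injective? : Dec (∀ i j → Vec.lookup π i ≡ Vec.lookup π j → i ≡ j)
  π-injective? = Fin.all? λ i → Fin.all? λ j → (Vec.lookup π i Fin.≟ Vec.lookup π j) →-dec (i Fin.≟ j)

  relabel-injective : {True π-injective?} → Injective _≡_ _≡_ relabel
  relabel-injective {w} eq = trans (sym (strictlyInverseʳ _)) (trans (cong from (toWitness w _ _ eq)) (strictlyInverseʳ _))
    where open Inverse (enum t)

  induced? : (N : ℕ → ℕ → Bool) → Dec (∀ u v → adj t u v ≡ N (toℕ (relabel u)) (toℕ (relabel v)))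
  induced? N = allVertices? t λ u → allVertices? t λ v → adj t u v Bool.≟ N (toℕ (relabel u)) (toℕ (relabel v))

  relabelling : ∀ es → {True π-injective?} → {True (n ≤? size t)} → {True (induced? (adjacent es))} →
    Iso (adj t) (fromEdges n es)
  relabelling es {w} {n≤} {i} =
    injective⇒Iso (fromEdges n es) relabel (relabel-injective {w}) (toWitness n≤) (toWitness i)

P₅-Iso : Iso (adj (• ⊕ spider 1)) (P 5)
P₅-Iso = relabelling (• ⊕ spider 1) (Vec.allFin 5) (pathEdges 5)

P₆-Iso : Iso (adj (• ⊕ (• ⊕ spider 1))) (P 6)
P₆-Iso = relabelling (• ⊕ (• ⊕ spider 1)) (Vec.allFin 6) (pathEdges 6)

K13-Iso : Iso (adj (cherry ⊕ •)) K13
K13-Iso = relabelling (cherry ⊕ •) (Vec.allFin 4) ((0 , 1) ∷ (0 , 2) ∷ (0 , 3) ∷ [])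

Tstar-Iso : Iso (adj (• ⊕ cherry ⊕ leg)) Tstar
-- In the order of `enum`: the neck 4, the hub 0, its leaves 1 and 2, then the leg 5, 6, 3.
Tstar-Iso = relabelling (• ⊕ cherry ⊕ leg) (# 4 ∷ # 0 ∷ # 1 ∷ # 2 ∷ # 5 ∷ # 6 ∷ # 3 ∷ [])
  ((0 , 1) ∷ (0 , 2) ∷ (0 , 4) ∷ (4 , 5) ∷ (5 , 6) ∷ (6 , 3) ∷ [])

size-spider : ∀ k → size (spider k) ≡ suc (3 * k)
size-spider k = trans (size-legs k •) (cong suc (*-comm k 3))

size-legs-F₂ : ∀ k → size (legs k F₂) ≡ suc (3 * (2 + k))
size-legs-F₂ k = trans (size-legs k F₂) (solve 1 (λ k → con 7 :+ k :* con 3 := con 1 :+ con 3 :* (con 2 :+ k)) refl k)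
  where open +-*-Solver

any-concatMap-upTo : {A : Set} (p : A → Bool) (f : ℕ → List A) → ∀ k →
  any p (concatMap f (upTo (suc k))) ≡ any p (concatMap f (upTo k)) ∨ any p (f k)
any-concatMap-upTo p f k = begin
  any p (concatMap f (upTo (suc k)))                ≡⟨ cong (any p ∘ concatMap f) (upTo-∷ʳ k) ⟨
  any p (concatMap f (upTo k ++ (k ∷ [])))          ≡⟨ cong (any p) (concatMap-++ f (upTo k) (k ∷ [])) ⟩
  any p (concatMap f (upTo k) ++ f k ++ [])         ≡⟨ any-++ p (concatMap f (upTo k)) (f k ++ []) ⟩
  any p (concatMap f (upTo k)) ∨ any p (f k ++ [])
    ≡⟨ cong (λ xs → any p (concatMap f (upTo k)) ∨ any p xs) (++-identityʳ (f k)) ⟩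
  any p (concatMap f (upTo k)) ∨ any p (f k)        ∎
  where open ≡-Reasoning

Tk-Numbering : ∀ k → Numbering (spider k) (adjacent (TkEdges k))
Tk-Numbering zero = record
  { num = λ _ → 0 ; num< = λ _ → s≤s z≤n ; injective = λ _ → refl ; num-root = refl
  ; induced = λ _ _ → refl ; outside = λ _ _ → refl , refl }
Tk-Numbering (suc k) = addLeg _ edges (Tk-Numbering k)
  where
  edges : ∀ a b → adjacent (TkEdges (suc k)) a b ≡
    adjacent (TkEdges k) a b ∨ adjacent (legEdges (size (spider k))) a b
  edges a b rewrite size-spider k = any-concatMap-upTo (edge? a b) (λ i → (0 , 1 + 3 * i) ∷ branchPath i) k

Tk-Iso : ∀ k → Iso (adj (spider k)) (Tk k)
Tk-Iso k = Numbering⇒Iso (TkEdges k) (size-spider k) (Tk-Numbering k)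

Fk-Numbering : ∀ k → Numbering (legs k F₂) (adjacent (FkEdges (2 + k)))
Fk-Numbering zero = record
  { num       = λ v → toℕ (relabel F₂ π v)
  ; num<      = λ v → Fin.toℕ<n (relabel F₂ π v)
  ; injective = relabel-injective F₂ π ∘ Fin.toℕ-injective
  ; num-root  = refl
  ; induced   = toWitness {a? = induced? F₂ π (adjacent (FkEdges 2))} tt
  ; outside   = adjacent-≥ (toWitness {a? = All.all? (λ (x , y) → (x <? 7) ×-dec (y <? 7)) (FkEdges 2)} tt)
  }
  where
  π : Vec (Fin 7) 7
  -- The centre 0, then `w` with its own path 4, 5, 6, then the moved leg 1, 2, 3.
  π = # 0 ∷ # 4 ∷ # 5 ∷ # 6 ∷ # 1 ∷ # 2 ∷ # 3 ∷ []
Fk-Numbering (suc k) = addLeg _ edges (Fk-Numbering k)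
  where
  edges : ∀ a b → adjacent (FkEdges (3 + k)) a b ≡
    adjacent (FkEdges (2 + k)) a b ∨ adjacent (legEdges (size (legs k F₂))) a b
  edges a b = begin
    e ∨ any p (B (suc k) ++ C (suc k))      ≡⟨ cong (e ∨_) (any-++ p (B (suc k)) (C (suc k))) ⟩
    e ∨ (any p (B (suc k)) ∨ any p (C (suc k)))
      ≡⟨ cong₂ (λ x y → e ∨ (x ∨ y)) (any-concatMap-upTo p branchPath (2 + k))
           (any-concatMap-upTo p (λ i → (0 , 4 + 3 * i) ∷ []) (1 + k)) ⟩
    e ∨ ((any p (B k) ∨ any p (branchPath (2 + k))) ∨ (any p (C k) ∨ (p (0 , 4 + 3 * (1 + k)) ∨ false)))
      ≡⟨ solve 5 (λ e x y z w → e :+ ((x :+ y) :+ (z :+ (w :+ con false))) := (e :+ (x :+ z)) :+ (w :+ y)) refl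
           e (any p (B k)) (any p (branchPath (2 + k))) (any p (C k)) (p (0 , 4 + 3 * (1 + k))) ⟩
    (e ∨ (any p (B k) ∨ any p (C k))) ∨ (p (0 , 4 + 3 * (1 + k)) ∨ any p (branchPath (2 + k)))
      ≡⟨ cong₂ _∨_ (cong (e ∨_) (sym (any-++ p (B k) (C k))))
           (cong₂ (λ x y → p (0 , x) ∨ (p (y , suc y) ∨ (p (suc y , 2 + y) ∨ false))) s≡ (sym (size-legs-F₂ k))) ⟩
    adjacent (FkEdges (2 + k)) a b ∨ adjacent (legEdges (size (legs k F₂))) a b ∎
    where
    open ≡-Reasoning
    open ∨-∧-Solver
    p = edge? a b
    e = p (1 , 4)
    -- Branch 0 is the moved leg and has no edge to the centre, so `C` runs over one index fewer and
    -- starts at vertex 4.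
    B C : ℕ → List (ℕ × ℕ)
    B k = concatMap branchPath (upTo (2 + k))
    C k = concatMap (λ i → (0 , 4 + 3 * i) ∷ []) (upTo (1 + k))
    s≡ : 4 + 3 * (1 + k) ≡ size (legs k F₂)
    s≡ = trans (cong suc (sym (*-suc 3 (1 + k)))) (sym (size-legs-F₂ k))

Fk-Iso : ∀ k → Iso (adj (legs k F₂)) (Fk (2 + k))
Fk-Iso k = Numbering⇒Iso (FkEdges (2 + k)) (size-legs-F₂ k) (Fk-Numbering k)

-- The bound and the case of equality.

Dominated-cong : {A : Set} {E : A → A → Bool} {S S′ : A → Bool} → (∀ v → S v ≡ S′ v) →
  ∀ {v} → Dominated E S v → Dominated E S′ v
Dominated-cong eq (inj₁ (u , s , e)) = inj₁ (u , trans (sym (eq u)) s , e)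
Dominated-cong eq (inj₂ (u , w , u≢w , s , s′ , d)) =
  inj₂ (u , w , u≢w , trans (sym (eq u)) s , trans (sym (eq w)) s′ , d)

-- With order `3k + 1` the bound `2(n - 1)/3` is the integer `2k`.
record Tight (t : RTree) : Set where
  field
    k     : ℕ
    order : size t ≡ suc (3 * k)
    lower : ∀ S → (∀ v → Dominated (adj t) S v) → 2 * k ≤ count t S

spider-Tight : ∀ k → Tight (spider k)
spider-Tight k = record
  { k = k ; order = size-spider k
  ; lower = λ S dom → subst (_≤ count (spider k) S) (*-comm k 2)
      (legs-lower • 0 (λ _ _ → z≤n) k S (λ v _ _ → dom v)) }

legs-F₂-Tight : ∀ k → Tight (legs k F₂)
legs-F₂-Tight k = record
  { k = 2 + k ; order = size-legs-F₂ k
  ; lower = λ S dom → subst (_≤ count (legs k F₂) S) (*-comm (2 + k) 2)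
      (legs-lower F₂ 4 F₂-lower k S (λ v _ _ → dom v)) }

K13-Tight : Tight (cherry ⊕ •)
K13-Tight = record { k = 1 ; order = refl ; lower = λ S dom → 2≤count-dominating (cherry ⊕ •) dom }

Tstar-Tight : Tight (• ⊕ cherry ⊕ leg)
Tstar-Tight = record { k = 2 ; order = refl ; lower = T*-lower }

module _ {n m : ℕ} (G : Graph n) (H : Graph m) where

  ≅-via : ∀ t → Iso (adj t) G → Iso (adj t) H → G ≅ H
  ≅-via t i j = Iso-trans {E = G} {adj t} {H = H} (Iso-sym {E = adj t} {G} i) j

  Iso-≅ : ∀ t → Iso (adj t) H → G ≅ H → Iso (adj t) G
  Iso-≅ t i j = Iso-trans {E = adj t} {H} {H = G} i (Iso-sym {E = G} {H} j)

Iso-~ : ∀ {n} (G : Graph n) {t u} → t ~ u → Iso (adj t) G → Iso (adj u) G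
Iso-~ G {t} {u} p i = Iso-trans {E = adj u} {adj t} {H = G} (iso (~-sym p)) i

family⇒Tight : ∀ {n} (G : Graph n) → InExtremalFamily G → ∃[ t ] Tight t × Iso (adj t) G
family⇒Tight G (inj₁ (k , _ , i)) = spider k , spider-Tight k , Iso-≅ G (Tk k) (spider k) (Tk-Iso k) i
family⇒Tight G (inj₂ (inj₁ (suc (suc k) , s≤s (s≤s _) , i))) =
  legs k F₂ , legs-F₂-Tight k , Iso-≅ G (Fk (2 + k)) (legs k F₂) (Fk-Iso k) i
family⇒Tight G (inj₂ (inj₂ (inj₁ i))) = cherry ⊕ • , K13-Tight , Iso-≅ G K13 (cherry ⊕ •) K13-Iso i
family⇒Tight G (inj₂ (inj₂ (inj₂ i))) = • ⊕ cherry ⊕ leg , Tstar-Tight , Iso-≅ G Tstar (• ⊕ cherry ⊕ leg) Tstar-Iso i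

Extremal⇒family : ∀ {n} (G : Graph n) {t} → Iso (adj t) G → Extremal t → InExtremalFamily G
Extremal⇒family G i (isT k p) =
  inj₁ (suc k , s≤s z≤n , ≅-via G (Tk (suc k)) (spider (suc k)) (Iso-~ G p i) (Tk-Iso (suc k)))
Extremal⇒family G i (isF k p) =
  inj₂ (inj₁ (2 + k , s≤s (s≤s z≤n) , ≅-via G (Fk (2 + k)) (legs k F₂) (Iso-~ G p i) (Fk-Iso k)))
Extremal⇒family G i (isK p)   = inj₂ (inj₂ (inj₁ (≅-via G K13 (cherry ⊕ •) (Iso-~ G p i) K13-Iso)))
Extremal⇒family G i (isT* p)  = inj₂ (inj₂ (inj₂ (≅-via G Tstar (• ⊕ cherry ⊕ leg) (Iso-~ G p i) Tstar-Iso)))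

module _ {n} {G : Graph n} {γ : ℕ} (isγ : IsGammaTd G γ) where

  upper : ∀ {t p} → Iso (adj t) G → HasDTD t p → 3 * γ + p ≤ 2 * n + 2
  upper {t} {p} i@(f , _) (S , r) = begin
    3 * γ + p                  ≤⟨ +-monoˡ-≤ p (*-monoʳ-≤ 3 (proj₂ isγ S′ (Dominated⇒IsDTD dominated))) ⟩
    3 * ∣ S′ ∣ + p             ≡⟨ cong (λ x → 3 * x + p) card ⟨
    3 * count t S + p          ≤⟨ Realises.cost r ⟩
    2 * size t + 2             ≡⟨ cong (λ x → 2 * x + 2) (size≡ f) ⟩
    2 * n + 2                  ∎
    where
    open ≤-Reasoning
    open Inverse f
    S′ : Subset n
    S′ = tabulate (S ∘ from)
    lookup-S′ : ∀ v → Vec.lookup S′ v ≡ S (from v)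
    lookup-S′ = lookup∘tabulate (S ∘ from)
    card : count t S ≡ ∣ S′ ∣
    card = trans (count-cong t λ v → sym (trans (lookup-S′ (to v)) (cong S (strictlyInverseʳ v)))) (count≡∣∣ f S′)
    dominated : ∀ v → Dominated G (Vec.lookup S′) v
    dominated v = Dominated-cong (sym ∘ lookup-S′)
      (Dominated-Iso (Iso-sym {E = adj t} {G} i) S v (Realises⇒Dominated r refl refl (from v)))

  lower : ∀ {t} → Iso (adj t) G → Tight t → 2 * (n ∸ 1) ≤ 3 * γ
  lower {t} i@(f , _) τ with (S , dtd , refl) ← proj₁ isγ = begin
    2 * (n ∸ 1)                               ≡⟨ cong (λ x → 2 * (x ∸ 1)) (trans (sym (size≡ f)) order) ⟩
    2 * (3 * k)                               ≡⟨ solve 1 (λ k → con 2 :* (con 3 :* k) := con 3 :* (con 2 :* k)) refl k ⟩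
    3 * (2 * k)                               ≤⟨ *-monoʳ-≤ 3 (Tight.lower τ _ λ v →
      Dominated-Iso i (Vec.lookup S) v (IsDTD⇒Dominated dtd (Inverse.to f v))) ⟩
    3 * count t (Vec.lookup S ∘ Inverse.to f) ≡⟨ cong (3 *_) (count≡∣∣ f S) ⟩
    3 * ∣ S ∣                                 ∎
    where
    open ≤-Reasoning
    open Tight τ using (k; order)
    open +-*-Solver

mainTheorem4 : (n : ℕ) (T : Graph n) → Symmetric T → Irreflexive T → IsTree T
    → 4 ≤ n → ¬ (T ≅ P 5) → ¬ (T ≅ P 6)
    → (γ : ℕ) → IsGammaTd T γ
    → (3 * γ ≤ 2 * (n ∸ 1)) × ((3 * γ ≡ 2 * (n ∸ 1)) ⇔ InExtremalFamily T)
mainTheorem4 (suc n) T T-sym T-irrefl (connected , acyclic) 4≤n T≇P₅ T≇P₆ γ isγ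
  with asRTree T-sym T-irrefl connected acyclic Fin.zero
... | • , i = contradiction (≤-trans 4≤n (≤-reflexive (sym (size≡ (proj₁ i))))) λ { (s≤s ()) }
... | a ⊕ b , i with c , p ← rootAtLeaf a b = conclude (verdict c)
  where
  i′ : Iso (adj (• ⊕ c)) T
  i′ = Iso-~ T p i
  -- Here the order is `suc n`: of the 4, one 2 is the constant inside `saving`, the other comes
  -- from `2 * suc n`.
  save : ∀ x → 3 * γ + (4 + x) ≤ 2 * suc n + 2 → 3 * γ + x ≤ 2 * n
  save x h = +-cancelʳ-≤ 4 _ _ (subst₂ _≤_
    (solve 2 (λ g x → g :+ (con 4 :+ x) := g :+ x :+ con 4) refl (3 * γ) x)
    (solve 1 (λ n → con 2 :* (con 1 :+ n) :+ con 2 := con 2 :* n :+ con 4) refl n) h)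
    where open +-*-Solver
  equality : 3 * γ ≤ 2 * n → InExtremalFamily T → 3 * γ ≡ 2 * n
  equality h e = let t , τ , j = family⇒Tight T e in ≤-antisym h (lower isγ j τ)
  conclude : Verdict c → (3 * γ ≤ 2 * n) × ((3 * γ ≡ 2 * n) ⇔ InExtremalFamily T)
  conclude (tiny h) = contradiction
    (≤-trans 4≤n (≤-trans (≤-reflexive (sym (size≡ (proj₁ i′)))) (s≤s h))) λ { (s≤s (s≤s (s≤s ()))) }
  conclude (path₅ refl) = contradiction (≅-via T (P 5) (• ⊕ c) i′ P₅-Iso) T≇P₅
  conclude (path₆ refl) = contradiction (≅-via T (P 6) (• ⊕ c) i′ P₆-Iso) T≇P₆
  conclude (tight h e)  = bound , mk⇔ (λ _ → Extremal⇒family T i′ e) (equality bound)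
    where
    bound : 3 * γ ≤ 2 * n
    bound = subst (_≤ 2 * n) (+-identityʳ _) (save 0 (upper isγ i′ h))
  conclude (strict h)   = <⇒≤ bound , mk⇔ (λ eq → contradiction eq (<⇒≢ bound)) (equality (<⇒≤ bound))
    where
    bound : 3 * γ < 2 * n
    bound = subst (_≤ 2 * n) (+-comm (3 * γ) 1) (save 1 (upper isγ i′ h))
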